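{- Let $u\ge \ell\ge 1$ and $m\ge 1$ be integers, let $n\coloneqq 2^\ell$, let $S\subset\mathbb{F}_2^u$ be a set of cardinality $m$, and let $\mathcal{H}$ be the set of all linear maps $\mathbb{F}_2^u\to\mathbb{F}_2^\ell$. For every $0<\varepsilon<1/2$ there exist constants $C_1<C_2$, depending only on $\varepsilon$, such that if $m\ge C_1^{ -1} n\log n$, then for $h$ drawn uniformly at random from $\mathcal{H}$, \[\Pr_{h\sim \mathcal{H}}\left[\forall y\in \mathbb{F}_2^\ell,~ C_1 \frac{m}{n}\le |h^{ -1}(y)\cap S|\le C_2 \frac{m}{n}\right] \ge 1-\varepsilon.\] Moreover, one can take $C_1 = \Omega(\varepsilon^{74})$ and $C_2 = O(\varepsilon^{ -1/2})$.
   Context: $\log$ denotes the base-2 logarithm. -}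

module Defs where

open import Data.Bool using (Bool; true; false; _∧_; _xor_)
import Data.Bool as B
open import Data.Nat using (ℕ; zero; suc)
open import Data.Integer using (+_)
open import Data.Rational using (ℚ; _/_; _*_; _≤_; 1ℚ)
import Data.Rational.Properties as ℚP
open import Data.List using (List; []; _∷_; map; concatMap; length; filter)
open import Data.List.Relation.Unary.All using (All; all?)
open import Data.Vec using (Vec; []; _∷_; zipWith; foldr)
import Data.Vec as V
open import Data.Vec.Properties using (≡-dec)
open import Relation.Binary.PropositionalEquality using (_≡_)
open import Relation.Nullary using (Dec)

-- Elements of 𝔽₂ are Booleans: false = 0, true = 1; addition is xor, multiplication is ∧.
𝔽₂ : Set
𝔽₂ = Bool

𝔽₂^ : ℕ → Set
𝔽₂^ n = Vec 𝔽₂ n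

allVec : {A : Set} → List A → (n : ℕ) → List (Vec A n)
allVec xs zero    = [] ∷ []
allVec xs (suc n) = concatMap (λ x → map (x ∷_) (allVec xs n)) xs

all𝔽₂^ : (n : ℕ) → List (𝔽₂^ n)
all𝔽₂^ n = allVec (false ∷ true ∷ []) n

-- A linear map 𝔽₂ᵘ → 𝔽₂ˡ is represented by its ℓ × u matrix (ℓ rows in 𝔽₂ᵘ).
LinMap : ℕ → ℕ → Set
LinMap u ℓ = Vec (𝔽₂^ u) ℓ

dot : {u : ℕ} → 𝔽₂^ u → 𝔽₂^ u → 𝔽₂
dot x y = foldr _ _xor_ false (zipWith _∧_ x y)

apply : {u ℓ : ℕ} → LinMap u ℓ → 𝔽₂^ u → 𝔽₂^ ℓ
apply h x = V.map (λ row → dot row x) h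

allLinMaps : (u ℓ : ℕ) → List (LinMap u ℓ)
allLinMaps u ℓ = allVec (all𝔽₂^ u) ℓ

_≟v_ : {n : ℕ} → (x y : 𝔽₂^ n) → Dec (x ≡ y)
_≟v_ = ≡-dec B._≟_

-- |h⁻¹(y) ∩ S|, for S given as a duplicate-free list
preimageCount : {u ℓ : ℕ} → LinMap u ℓ → List (𝔽₂^ u) → 𝔽₂^ ℓ → ℕ
preimageCount h S y = length (filter (λ x → apply h x ≟v y) S)

ℕtoℚ : ℕ → ℚ
ℕtoℚ k = (+ k) / 1

_^ℚ_ : ℚ → ℕ → ℚ
q ^ℚ zero  = 1ℚ
q ^ℚ suc k = q * (q ^ℚ k)

-- The event: for all y ∈ 𝔽₂ˡ,  C₁·m/n ≤ |h⁻¹(y) ∩ S| ≤ C₂·m/n,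
-- written with denominators cleared (n = 2^ℓ > 0):  C₁·m ≤ |…|·n  and  |…|·n ≤ C₂·m.
Balanced : {u ℓ : ℕ} → ℚ → ℚ → (n m : ℕ) → List (𝔽₂^ u) → LinMap u ℓ → Set
Balanced {u} {ℓ} C₁ C₂ n m S h =
  All (λ y → (C₁ * ℕtoℚ m ≤ ℕtoℚ (preimageCount h S y) * ℕtoℚ n)
            Data.Product.× (ℕtoℚ (preimageCount h S y) * ℕtoℚ n ≤ C₂ * ℕtoℚ m))
      (all𝔽₂^ ℓ)
  where import Data.Product

balanced? : {u ℓ : ℕ} → (C₁ C₂ : ℚ) → (n m : ℕ) → (S : List (𝔽₂^ u)) → (h : LinMap u ℓ) → Dec (Balanced C₁ C₂ n m S h)
balanced? {u} {ℓ} C₁ C₂ n m S h =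
  all? (λ y → (C₁ * ℕtoℚ m ℚP.≤? ℕtoℚ (preimageCount h S y) * ℕtoℚ n)
              ×-dec (ℕtoℚ (preimageCount h S y) * ℕtoℚ n ℚP.≤? C₂ * ℕtoℚ m))
       (all𝔽₂^ ℓ)
  where open import Relation.Nullary.Decidable using (_×-dec_)

goodCount : (u ℓ : ℕ) → ℚ → ℚ → (n m : ℕ) → List (𝔽₂^ u) → ℕ
goodCount u ℓ C₁ C₂ n m S = length (filter (balanced? C₁ C₂ n m S) (allLinMaps u ℓ))

{-# OPTIONS --safe #-}
-- A uniform linear map into 𝔽₂^ d is obtained from a uniform one into 𝔽₂^ (d + 1) by merging, for a
-- uniform w, the bins (0 , y) and (1 , y ⊕ w).  If g is multiplicative in the load f, then the
-- expectation over w of the new mean of g is the product of two half means, hence at most the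
-- square of the old mean.  We follow this from a large number N of bins down to n = 2 ^ ℓ.
--
-- Lower tail: let Ψ be the mean of 2^(−f).  If failure has probability at most r Ψ after a merge, it
-- has probability at most min (1 , r Ψ²) ≤ √r Ψ before it.  Starting from r = 2^(2^J), enough to
-- detect a bin with load below m / (R n), undoing J merges leads to r = 2 at N ≤ 4 m / R bins,
-- where pairwise independence gives E Ψ ≤ 2 N / m.
--
-- Upper tail: the mean of 2^f is 1 + m / N + X / N, with X the sum over the bins of 2^f − 1 − f.
-- Merging doubles X / N up to the error (m / N)² + (X / N)².  Failure has probability at most
-- A (X / N + (m / N)²), where A starts at 8 · 16^(−2^I) and, up to constants, is replaced by its
-- square root for every merge undone, until A is constant at N = M ≈ 4 ν m.  From there on A grows
-- linearly in N and the accumulated error is O ((m / M)²) = O (ν⁻²); as N → ∞, the mean of X tends to 0.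
-- Markov's inequality is spent only on X, not on the deterministic m / N, which is why
-- ν ≈ ε^(−1/2) suffices instead of ε⁻¹.
module Submission where

open import Defs
open import Data.Bool using (true; false; _∧_; _xor_; if_then_else_; not)
import Data.Bool as Bool
open import Data.Bool.Properties using (xor-comm; xor-identityʳ; ∧-comm)
open import Data.Bool.Solver using (module xor-∧-Solver)
open import Data.Nat using (ℕ; zero; suc; _^_; NonZero; s≤s; z≤n)
import Data.Nat as ℕ
import Data.Nat.Properties as ℕP
open import Data.Nat.Tactic.RingSolver using (solve-∀)
open import Data.List using (List; []; _∷_; length; map; concatMap; filter; _++_)
open import Data.List.Membership.Propositional using (_∈_)
open import Data.List.Membership.Propositional.Properties using (∈-map⁺; ∈-++⁺ˡ; ∈-++⁺ʳ)
open import Data.List.Relation.Unary.All as All using (All; []; _∷_)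
open import Data.List.Relation.Unary.All.Properties using (¬Any⇒All¬)
open import Data.List.Relation.Unary.AllPairs using ([]; _∷_)
open import Data.List.Relation.Unary.Any as Any using (any?; here; there)
open import Data.List.Relation.Unary.Unique.Propositional using (Unique)
open import Data.Product using (Σ; _×_; _,_; proj₁; proj₂; ∃)
open import Data.Sum using (_⊎_; inj₁; inj₂)
open import Data.Vec using (Vec; []; _∷_; zipWith)
import Data.Vec as V
open import Relation.Nullary using (Dec; yes; no; does; ¬_; contradiction)
open import Relation.Unary using (Decidable)
open import Relation.Binary.PropositionalEquality using (_≡_; _≢_; refl; sym; trans; cong; cong₂; subst; module ≡-Reasoning)

module Counting where

  open import Data.Nat using (_+_; _*_; _∸_; _≤_; _<_; _≤?_; >-nonZero; >-nonZero⁻¹)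
  open import Data.Nat.Properties

  private variable
    A B : Set
    n d u : ℕ

  -- Sums over lists and over 𝔽₂^ n

  ∑ : List A → (A → ℕ) → ℕ
  ∑ []       f = 0
  ∑ (x ∷ xs) f = f x + ∑ xs f

  ∑-cong : ∀ (xs : List A) {f g : A → ℕ} → (∀ x → f x ≡ g x) → ∑ xs f ≡ ∑ xs g
  ∑-cong []       e = refl
  ∑-cong (x ∷ xs) e = cong₂ _+_ (e x) (∑-cong xs e)

  ∑-mono : ∀ (xs : List A) {f g : A → ℕ} → (∀ x → f x ≤ g x) → ∑ xs f ≤ ∑ xs g
  ∑-mono []       e = z≤n
  ∑-mono (x ∷ xs) e = +-mono-≤ (e x) (∑-mono xs e)

  ∑-+ : ∀ (xs : List A) (f g : A → ℕ) → ∑ xs (λ x → f x + g x) ≡ ∑ xs f + ∑ xs g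
  ∑-+ []       f g = refl
  ∑-+ (x ∷ xs) f g = trans (cong (f x + g x +_) (∑-+ xs f g)) (interchange (f x) (g x) _ _)
    where
    interchange : ∀ a b c e → a + b + (c + e) ≡ a + c + (b + e)
    interchange = solve-∀

  ∑-*ˡ : ∀ (xs : List A) c (f : A → ℕ) → ∑ xs (λ x → c * f x) ≡ c * ∑ xs f
  ∑-*ˡ []       c f = sym (*-zeroʳ c)
  ∑-*ˡ (x ∷ xs) c f = trans (cong (c * f x +_) (∑-*ˡ xs c f)) (sym (*-distribˡ-+ c (f x) _))

  ∑-*ʳ : ∀ (xs : List A) c (f : A → ℕ) → ∑ xs (λ x → f x * c) ≡ ∑ xs f * c
  ∑-*ʳ xs c f = trans (∑-cong xs λ x → *-comm (f x) c) (trans (∑-*ˡ xs c f) (*-comm c _))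

  ∑-const : ∀ (xs : List A) c → ∑ xs (λ _ → c) ≡ length xs * c
  ∑-const []       c = refl
  ∑-const (x ∷ xs) c = cong (c +_) (∑-const xs c)

  ∑-zero : ∀ (xs : List A) → ∑ xs (λ _ → 0) ≡ 0
  ∑-zero xs = trans (∑-const xs 0) (*-zeroʳ (length xs))

  ∑-swap : ∀ (xs : List A) (ys : List B) (f : A → B → ℕ) →
           ∑ xs (λ x → ∑ ys (f x)) ≡ ∑ ys (λ y → ∑ xs (λ x → f x y))
  ∑-swap []       ys f = sym (∑-zero ys)
  ∑-swap (x ∷ xs) ys f = trans (cong (∑ ys (f x) +_) (∑-swap xs ys f)) (sym (∑-+ ys (f x) _))

  ∑-++ : ∀ (xs ys : List A) (f : A → ℕ) → ∑ (xs ++ ys) f ≡ ∑ xs f + ∑ ys f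
  ∑-++ []       ys f = refl
  ∑-++ (x ∷ xs) ys f = trans (cong (f x +_) (∑-++ xs ys f)) (sym (+-assoc (f x) _ _))

  ∑-map : ∀ (g : A → B) xs (f : B → ℕ) → ∑ (map g xs) f ≡ ∑ xs (λ x → f (g x))
  ∑-map g []       f = refl
  ∑-map g (x ∷ xs) f = cong (f (g x) +_) (∑-map g xs f)

  ∑-concatMap : ∀ (g : A → List B) xs (f : B → ℕ) → ∑ (concatMap g xs) f ≡ ∑ xs (λ x → ∑ (g x) f)
  ∑-concatMap g []       f = refl
  ∑-concatMap g (x ∷ xs) f = trans (∑-++ (g x) _ f) (cong (∑ (g x) f +_) (∑-concatMap g xs f))

  ∑-∈ : ∀ {xs : List A} (f : A → ℕ) {x} → x ∈ xs → f x ≤ ∑ xs f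
  ∑-∈ f (here refl) = m≤m+n _ _
  ∑-∈ f (there p)   = ≤-trans (∑-∈ f p) (m≤n+m _ _)

  ∑-allVec : ∀ (xs : List A) n (f : Vec A (suc n) → ℕ) →
             ∑ (allVec xs (suc n)) f ≡ ∑ xs (λ x → ∑ (allVec xs n) (λ v → f (x ∷ v)))
  ∑-allVec xs n f = trans (∑-concatMap _ xs f) (∑-cong xs λ x → ∑-map (x ∷_) (allVec xs n) f)

  length-∑ : ∀ (xs : List A) → length xs ≡ ∑ xs (λ _ → 1)
  length-∑ xs = sym (trans (∑-const xs 1) (*-identityʳ _))

  length-allVec : ∀ (xs : List A) n → length (allVec xs n) ≡ length xs ^ n
  length-allVec xs zero    = refl
  length-allVec xs (suc n) = begin
    length (allVec xs (suc n))                  ≡⟨ length-∑ (allVec xs (suc n)) ⟩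
    ∑ (allVec xs (suc n)) (λ _ → 1)             ≡⟨ ∑-allVec xs n _ ⟩
    ∑ xs (λ _ → ∑ (allVec xs n) (λ _ → 1))      ≡⟨ ∑-cong xs (λ _ → trans (sym (length-∑ (allVec xs n))) (length-allVec xs n)) ⟩
    ∑ xs (λ _ → length xs ^ n)                  ≡⟨ ∑-const xs _ ⟩
    length xs * length xs ^ n                   ∎
    where open ≡-Reasoning

  ∑𝔽 : (n : ℕ) → (𝔽₂^ n → ℕ) → ℕ
  ∑𝔽 n = ∑ (all𝔽₂^ n)

  ∑𝔽-suc : ∀ n (f : 𝔽₂^ (suc n) → ℕ) →
           ∑𝔽 (suc n) f ≡ ∑𝔽 n (λ x → f (false ∷ x)) + ∑𝔽 n (λ x → f (true ∷ x))
  ∑𝔽-suc n f = trans (∑-allVec _ n f) (cong (∑𝔽 n (λ x → f (false ∷ x)) +_) (+-identityʳ _))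

  ∑𝔽-const : ∀ n c → ∑𝔽 n (λ _ → c) ≡ 2 ^ n * c
  ∑𝔽-const n c = trans (∑-const (all𝔽₂^ n) c) (cong (_* c) (length-allVec _ n))

  -- Translations of the cube and convolution

  infixl 6 _⊕_
  _⊕_ : 𝔽₂^ n → 𝔽₂^ n → 𝔽₂^ n
  _⊕_ = zipWith _xor_

  infixl 7 _·_
  _·_ : 𝔽₂ → 𝔽₂^ n → 𝔽₂^ n
  b · x = V.map (b ∧_) x

  -- Induction over the coordinates: a leading bit `true` in `v` merely exchanges the two halves of
  -- the cube, which is `flip`.
  ∑𝔽-⊕ : ∀ (v : 𝔽₂^ n) (f : 𝔽₂^ n → ℕ) → ∑𝔽 n (λ x → f (x ⊕ v)) ≡ ∑𝔽 n f
  ∑𝔽-⊕ []                 f = refl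
  ∑𝔽-⊕ {suc n} (b ∷ v) f = trans (∑𝔽-suc n _) (trans (cong₂ _+_
      (∑𝔽-⊕ v (λ x → f ((false xor b) ∷ x))) (∑𝔽-⊕ v (λ x → f ((true xor b) ∷ x))))
      (trans (flip b) (sym (∑𝔽-suc n f))))
    where
    flip : ∀ b → ∑𝔽 n (λ x → f ((false xor b) ∷ x)) + ∑𝔽 n (λ x → f ((true xor b) ∷ x))
               ≡ ∑𝔽 n (λ x → f (false ∷ x)) + ∑𝔽 n (λ x → f (true ∷ x))
    flip false = refl
    flip true  = +-comm (∑𝔽 n (λ x → f (true ∷ x))) _

  ⊕-comm : ∀ (x y : 𝔽₂^ n) → x ⊕ y ≡ y ⊕ x
  ⊕-comm []      []      = refl
  ⊕-comm (a ∷ x) (b ∷ y) = cong₂ _∷_ (xor-comm a b) (⊕-comm x y)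

  ∑𝔽-⊕ˡ : ∀ (v : 𝔽₂^ n) (f : 𝔽₂^ n → ℕ) → ∑𝔽 n (λ x → f (v ⊕ x)) ≡ ∑𝔽 n f
  ∑𝔽-⊕ˡ v f = trans (∑-cong (all𝔽₂^ _) λ x → cong f (⊕-comm v x)) (∑𝔽-⊕ v f)

  -- For fixed `y` the point `y ⊕ w` runs through the whole cube with `w`. So the two bins merged by
  -- a uniform `w` behave like independent samples from the two halves.
  ∑𝔽-convolution : ∀ n (a b : 𝔽₂^ n → ℕ) →
                   ∑𝔽 n (λ w → ∑𝔽 n (λ y → a y * b (y ⊕ w))) ≡ ∑𝔽 n a * ∑𝔽 n b
  ∑𝔽-convolution n a b = begin
    ∑𝔽 n (λ w → ∑𝔽 n (λ y → a y * b (y ⊕ w)))  ≡⟨ ∑-swap (all𝔽₂^ n) (all𝔽₂^ n) _ ⟩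
    ∑𝔽 n (λ y → ∑𝔽 n (λ w → a y * b (y ⊕ w)))  ≡⟨ ∑-cong (all𝔽₂^ n) (λ y → ∑-*ˡ (all𝔽₂^ n) (a y) _) ⟩
    ∑𝔽 n (λ y → a y * ∑𝔽 n (λ w → b (y ⊕ w)))  ≡⟨ ∑-cong (all𝔽₂^ n) (λ y → cong (a y *_) (∑𝔽-⊕ˡ y b)) ⟩
    ∑𝔽 n (λ y → a y * ∑𝔽 n b)                  ≡⟨ ∑-*ʳ (all𝔽₂^ n) _ a ⟩
    ∑𝔽 n a * ∑𝔽 n b                            ∎
    where open ≡-Reasoning

  -- Indicators

  ind : {P : Set} → Dec P → ℕ
  ind p = if does p then 1 else 0

  ind-≤1 : {P : Set} (p : Dec P) → ind p ≤ 1
  ind-≤1 (yes _) = ≤-refl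
  ind-≤1 (no _)  = z≤n

  length-filter : {P : A → Set} (P? : Decidable P) (xs : List A) →
                  length (filter P? xs) ≡ ∑ xs (λ x → ind (P? x))
  length-filter P? []       = refl
  length-filter P? (x ∷ xs) with P? x
  ... | yes _ = cong suc (length-filter P? xs)
  ... | no _  = length-filter P? xs

  ⟦_≡_⟧ : 𝔽₂^ n → 𝔽₂^ n → ℕ
  ⟦ x ≡ y ⟧ = ind (x ≟v y)

  ∑𝔽-⟦≡⟧ : ∀ (v : 𝔽₂^ n) (f : 𝔽₂^ n → ℕ) → ∑𝔽 n (λ y → ⟦ v ≡ y ⟧ * f y) ≡ f v
  ∑𝔽-⟦≡⟧ []      f = trans (+-identityʳ _) (+-identityʳ _)
  ∑𝔽-⟦≡⟧ {suc n} (false ∷ v) f = trans (∑𝔽-suc n _) (trans (cong₂ _+_ (∑𝔽-⟦≡⟧ v _) (∑-zero (all𝔽₂^ n))) (+-identityʳ _))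
  ∑𝔽-⟦≡⟧ {suc n} (true ∷ v)  f = trans (∑𝔽-suc n _) (cong₂ _+_ (∑-zero (all𝔽₂^ n)) (∑𝔽-⟦≡⟧ v _))

  ⟦⊕≡⟧ : ∀ (x y w : 𝔽₂^ n) → ⟦ x ⊕ w ≡ y ⟧ ≡ ⟦ x ≡ y ⊕ w ⟧
  ⟦⊕≡⟧ []      []      []      = refl
  ⟦⊕≡⟧ (false ∷ x) (false ∷ y) (false ∷ w) = ⟦⊕≡⟧ x y w
  ⟦⊕≡⟧ (false ∷ x) (false ∷ y) (true  ∷ w) = refl
  ⟦⊕≡⟧ (false ∷ x) (true  ∷ y) (false ∷ w) = refl
  ⟦⊕≡⟧ (false ∷ x) (true  ∷ y) (true  ∷ w) = ⟦⊕≡⟧ x y w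
  ⟦⊕≡⟧ (true  ∷ x) (false ∷ y) (false ∷ w) = refl
  ⟦⊕≡⟧ (true  ∷ x) (false ∷ y) (true  ∷ w) = ⟦⊕≡⟧ x y w
  ⟦⊕≡⟧ (true  ∷ x) (true  ∷ y) (false ∷ w) = ⟦⊕≡⟧ x y w
  ⟦⊕≡⟧ (true  ∷ x) (true  ∷ y) (true  ∷ w) = refl

  dot-⊕ : ∀ (b : 𝔽₂) (s r x : 𝔽₂^ n) → dot (s ⊕ b · r) x ≡ dot s x xor (b ∧ dot r x)
  dot-⊕ false []      []      []      = refl
  dot-⊕ true  []      []      []      = refl
  dot-⊕ b (s ∷ ss) (r ∷ rs) (x ∷ xs) rewrite dot-⊕ b ss rs xs = bits b s r x (dot ss xs) (dot rs xs)
    where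
    open xor-∧-Solver
    bits : ∀ b s r x p q → ((s xor (b ∧ r)) ∧ x) xor (p xor (b ∧ q)) ≡ ((s ∧ x) xor p) xor (b ∧ ((r ∧ x) xor q))
    bits = solve 6 (λ b s r x p q → (s :+ b :* r) :* x :+ (p :+ b :* q) := (s :* x :+ p) :+ b :* (r :* x :+ q)) refl

  -- Sums over linear maps, and removal of one row

  ∑L : (u d : ℕ) → (LinMap u d → ℕ) → ℕ
  ∑L u d = ∑ (allLinMaps u d)

  -- A row operation with pivot row `r`; the coordinates of `w` are the multipliers.
  addRow : 𝔽₂^ u → 𝔽₂^ d → LinMap u d → LinMap u d
  addRow r = zipWith (λ b s → s ⊕ b · r)

  -- Postcomposition of h with the projection (b , x) ↦ x ⊕ b · w, whose kernel is spanned by (1 , w).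
  reduce : 𝔽₂^ d → LinMap u (suc d) → LinMap u d
  reduce w (r ∷ rs) = addRow r w rs

  -- With `r` and `w` fixed, every row is translated by a fixed vector, which permutes the matrices.
  ∑L-addRow : ∀ (r : 𝔽₂^ u) (w : 𝔽₂^ d) (F : LinMap u d → ℕ) → ∑L u d (λ h → F (addRow r w h)) ≡ ∑L u d F
  ∑L-addRow r [] F = refl
  ∑L-addRow {u} {suc d} r (b ∷ w) F = begin
    ∑L u (suc d) (λ h → F (addRow r (b ∷ w) h))                     ≡⟨ ∑-allVec (all𝔽₂^ u) d _ ⟩
    ∑𝔽 u (λ s → ∑L u d (λ h → F ((s ⊕ b · r) ∷ addRow r w h)))      ≡⟨ ∑-cong (all𝔽₂^ u) (λ s → ∑L-addRow r w (λ h → F ((s ⊕ b · r) ∷ h))) ⟩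
    ∑𝔽 u (λ s → ∑L u d (λ h → F ((s ⊕ b · r) ∷ h)))                 ≡⟨ ∑𝔽-⊕ (b · r) (λ s → ∑L u d (λ h → F (s ∷ h))) ⟩
    ∑𝔽 u (λ s → ∑L u d (λ h → F (s ∷ h)))                           ≡⟨ ∑-allVec (all𝔽₂^ u) d F ⟨
    ∑L u (suc d) F                                                  ∎
    where open ≡-Reasoning

  -- The remaining rows stay uniform for every choice of the removed row and of `w`; these choices
  -- account for the factors `2 ^ u` and `2 ^ d`. A uniform map followed by a uniform reduction is
  -- therefore uniform.
  ∑L-reduce : ∀ u d (F : LinMap u d → ℕ) →
              ∑L u (suc d) (λ h → ∑𝔽 d (λ w → F (reduce w h))) ≡ 2 ^ u * (2 ^ d * ∑L u d F)
  ∑L-reduce u d F = begin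
    ∑L u (suc d) (λ h → ∑𝔽 d (λ w → F (reduce w h)))                ≡⟨ ∑-allVec (all𝔽₂^ u) d _ ⟩
    ∑𝔽 u (λ r → ∑L u d (λ rs → ∑𝔽 d (λ w → F (addRow r w rs))))     ≡⟨ ∑-cong (all𝔽₂^ u) (λ r → ∑-swap (allLinMaps u d) (all𝔽₂^ d) _) ⟩
    ∑𝔽 u (λ r → ∑𝔽 d (λ w → ∑L u d (λ rs → F (addRow r w rs))))     ≡⟨ ∑-cong (all𝔽₂^ u) (λ r → ∑-cong (all𝔽₂^ d) λ w → ∑L-addRow r w F) ⟩
    ∑𝔽 u (λ r → ∑𝔽 d (λ w → ∑L u d F))                              ≡⟨ ∑-cong (all𝔽₂^ u) (λ r → ∑𝔽-const d _) ⟩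
    ∑𝔽 u (λ r → 2 ^ d * ∑L u d F)                                   ≡⟨ ∑𝔽-const u _ ⟩
    2 ^ u * (2 ^ d * ∑L u d F)                                      ∎
    where open ≡-Reasoning

  apply-addRow : ∀ (r : 𝔽₂^ u) (w : 𝔽₂^ d) (h : LinMap u d) x → apply (addRow r w h) x ≡ apply h x ⊕ dot r x · w
  apply-addRow r []      []      x = refl
  apply-addRow r (b ∷ w) (s ∷ h) x = cong₂ _∷_
    (trans (dot-⊕ b s r x) (cong (dot s x xor_) (∧-comm b (dot r x)))) (apply-addRow r w h x)

  false·-⊕ : ∀ (y w : 𝔽₂^ n) → y ⊕ false · w ≡ y
  false·-⊕ []      []      = refl
  false·-⊕ (a ∷ y) (b ∷ w) = cong₂ _∷_ (xor-identityʳ a) (false·-⊕ y w)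

  true· : ∀ (w : 𝔽₂^ n) → true · w ≡ w
  true· []      = refl
  true· (b ∷ w) = cong (b ∷_) (true· w)

  -- Loads of the bins under reduction

  load : LinMap u d → List (𝔽₂^ u) → 𝔽₂^ d → ℕ
  load h S y = ∑ S (λ x → ⟦ apply h x ≡ y ⟧)

  preimageCount≡load : ∀ (h : LinMap u d) S y → preimageCount h S y ≡ load h S y
  preimageCount≡load h S y = length-filter (λ x → apply h x ≟v y) S

  merge : 𝔽₂^ d → (𝔽₂^ (suc d) → ℕ) → 𝔽₂^ d → ℕ
  merge w φ y = φ (false ∷ y) + φ (true ∷ (y ⊕ w))

  -- The projection behind `reduce w` sends exactly `false ∷ y` and `true ∷ (y ⊕ w)` to `y`.
  load-reduce : ∀ (w : 𝔽₂^ d) (h : LinMap u (suc d)) S y → load (reduce w h) S y ≡ merge w (load h S) y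
  load-reduce w (r ∷ rs) S y = trans (∑-cong S pointwise) (∑-+ S _ _)
    where
    split : ∀ b z → ⟦ z ⊕ b · w ≡ y ⟧ ≡ ⟦ b ∷ z ≡ false ∷ y ⟧ + ⟦ b ∷ z ≡ true ∷ (y ⊕ w) ⟧
    split false z rewrite false·-⊕ z w = sym (+-identityʳ _)
    split true  z rewrite true· w = ⟦⊕≡⟧ z y w
    pointwise : ∀ x → ⟦ apply (addRow r w rs) x ≡ y ⟧ ≡
                ⟦ apply (r ∷ rs) x ≡ false ∷ y ⟧ + ⟦ apply (r ∷ rs) x ≡ true ∷ (y ⊕ w) ⟧
    pointwise x rewrite apply-addRow r w rs x = split (dot r x) (apply rs x)

  ∑-load : ∀ (h : LinMap u d) S → ∑𝔽 d (load h S) ≡ length S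
  ∑-load {d = d} h S = begin
    ∑𝔽 d (load h S)                               ≡⟨ ∑-swap (all𝔽₂^ d) S _ ⟩
    ∑ S (λ x → ∑𝔽 d (λ y → ⟦ apply h x ≡ y ⟧))    ≡⟨ ∑-cong S (λ x → trans (∑-cong (all𝔽₂^ d) λ y → sym (*-identityʳ _)) (∑𝔽-⟦≡⟧ (apply h x) (λ _ → 1))) ⟩
    ∑ S (λ x → 1)                                 ≡⟨ length-∑ S ⟨
    length S                                      ∎
    where open ≡-Reasoning

  -- Pairwise independence

  ⟦_≡ᵇ_⟧ : 𝔽₂ → 𝔽₂ → ℕ
  ⟦ a ≡ᵇ b ⟧ = ind (a Bool.≟ b)

  ⟦∷≡∷⟧ : ∀ a b (x y : 𝔽₂^ n) → ⟦ a ∷ x ≡ b ∷ y ⟧ ≡ ⟦ a ≡ᵇ b ⟧ * ⟦ x ≡ y ⟧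
  ⟦∷≡∷⟧ false false x y = sym (+-identityʳ _)
  ⟦∷≡∷⟧ false true  x y = refl
  ⟦∷≡∷⟧ true  false x y = refl
  ⟦∷≡∷⟧ true  true  x y = sym (+-identityʳ _)

  ⟦not≡not⟧ : ∀ a b → ⟦ not a ≡ᵇ not b ⟧ ≡ ⟦ a ≡ᵇ b ⟧
  ⟦not≡not⟧ false false = refl
  ⟦not≡not⟧ false true  = refl
  ⟦not≡not⟧ true  false = refl
  ⟦not≡not⟧ true  true  = refl

  ⟦≡⟧+⟦not≡⟧ : ∀ a b → ⟦ a ≡ᵇ b ⟧ + ⟦ not a ≡ᵇ b ⟧ ≡ 1
  ⟦≡⟧+⟦not≡⟧ false false = refl
  ⟦≡⟧+⟦not≡⟧ false true  = refl
  ⟦≡⟧+⟦not≡⟧ true  false = refl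
  ⟦≡⟧+⟦not≡⟧ true  true  = refl

  agree differ : 𝔽₂^ u → 𝔽₂^ u → ℕ
  agree  {u} s t = ∑𝔽 u (λ r → ⟦ dot r s ≡ᵇ dot r t ⟧)
  differ {u} s t = ∑𝔽 u (λ r → ⟦ not (dot r s) ≡ᵇ dot r t ⟧)

  -- Split by the first bit of the row. If the points have equal first bits, their tails are
  -- distinct and both halves follow by induction. If not, setting that bit of the row turns
  -- agreement into disagreement, and the two halves trade places.
  agree≡differ : ∀ (s t : 𝔽₂^ u) → s ≢ t → agree s t ≡ differ s t
  agree≡differ []      []      s≢t = contradiction refl s≢t
  agree≡differ {suc u} (a ∷ s) (b ∷ t) s≢t =
    trans (∑𝔽-suc u _) (trans (cases a b s≢t) (sym (∑𝔽-suc u _)))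
    where
    E N : 𝔽₂ → 𝔽₂ → ℕ
    E a b = ∑𝔽 u (λ r → ⟦ a xor dot r s ≡ᵇ b xor dot r t ⟧)
    N a b = ∑𝔽 u (λ r → ⟦ not (a xor dot r s) ≡ᵇ b xor dot r t ⟧)
    not-not : ∀ p q → ⟦ not (not p) ≡ᵇ q ⟧ ≡ ⟦ p ≡ᵇ q ⟧
    not-not false q = refl
    not-not true  q = refl
    not-swap : ∀ p q → ⟦ p ≡ᵇ not q ⟧ ≡ ⟦ not p ≡ᵇ q ⟧
    not-swap p q = trans (sym (⟦not≡not⟧ p (not q))) (aux (not p) q)
      where
      aux : ∀ p q → ⟦ p ≡ᵇ not (not q) ⟧ ≡ ⟦ p ≡ᵇ q ⟧
      aux p false = refl
      aux p true  = refl
    cases : ∀ a b → a ∷ s ≢ b ∷ t → E false false + E a b ≡ N false false + N a b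
    cases false false p = cong₂ _+_ ih ih where ih = agree≡differ s t (λ e → p (cong (false ∷_) e))
    cases true  true  p = cong₂ _+_ ih (trans (∑-cong (all𝔽₂^ u) (λ r → ⟦not≡not⟧ (dot r s) (dot r t)))
                            (trans ih (∑-cong (all𝔽₂^ u) λ r → sym (⟦not≡not⟧ (not (dot r s)) (dot r t)))))
      where ih = agree≡differ s t (λ e → p (cong (true ∷_) e))
    cases false true  p = trans (+-comm (E false false) _) (cong₂ _+_
      (∑-cong (all𝔽₂^ u) λ r → not-swap (dot r s) (dot r t))
      (∑-cong (all𝔽₂^ u) λ r → sym (⟦not≡not⟧ (dot r s) (dot r t))))
    cases true  false p = trans (+-comm (E false false) _) (cong (differ s t +_)
      (∑-cong (all𝔽₂^ u) λ r → sym (not-not (dot r s) (dot r t))))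

  2*agree : ∀ (s t : 𝔽₂^ u) → s ≢ t → 2 * agree s t ≡ 2 ^ u
  2*agree {u} s t s≢t = begin
    2 * agree s t             ≡⟨ cong (agree s t +_) (+-identityʳ _) ⟩
    agree s t + agree s t     ≡⟨ cong (agree s t +_) (agree≡differ s t s≢t) ⟩
    agree s t + differ s t    ≡⟨ ∑-+ (all𝔽₂^ u) _ _ ⟨
    ∑𝔽 u (λ r → ⟦ dot r s ≡ᵇ dot r t ⟧ + ⟦ not (dot r s) ≡ᵇ dot r t ⟧)
                              ≡⟨ ∑-cong (all𝔽₂^ u) (λ r → ⟦≡⟧+⟦not≡⟧ (dot r s) (dot r t)) ⟩
    ∑𝔽 u (λ _ → 1)            ≡⟨ ∑𝔽-const u 1 ⟩
    2 ^ u * 1                 ≡⟨ *-identityʳ _ ⟩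
    2 ^ u                     ∎
    where open ≡-Reasoning

  #L : ℕ → ℕ → ℕ
  #L u d = length (allLinMaps u d)

  #L-suc : ∀ u d → #L u (suc d) ≡ 2 ^ u * #L u d
  #L-suc u d = trans (length-allVec (all𝔽₂^ u) (suc d))
    (cong₂ _*_ (length-allVec (false ∷ true ∷ []) u) (sym (length-allVec (all𝔽₂^ u) d)))

  collisions : 𝔽₂^ u → 𝔽₂^ u → ℕ → ℕ
  collisions {u} s t d = ∑L u d (λ h → ⟦ apply h s ≡ apply h t ⟧)

  -- The rows of `h` are independent, and by `2*agree` each fails to separate `s` from `t` for
  -- exactly half of its values.
  2^*collisions : ∀ (s t : 𝔽₂^ u) → s ≢ t → ∀ d → 2 ^ d * collisions s t d ≡ #L u d
  2^*collisions s t s≢t zero = refl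
  2^*collisions {u} s t s≢t (suc d) = begin
    2 ^ suc d * collisions s t (suc d)
      ≡⟨ cong (2 ^ suc d *_) (∑-allVec (all𝔽₂^ u) d _) ⟩
    2 ^ suc d * ∑𝔽 u (λ r → ∑L u d (λ h → ⟦ dot r s ∷ apply h s ≡ dot r t ∷ apply h t ⟧))
      ≡⟨ cong (2 ^ suc d *_) (∑-cong (all𝔽₂^ u) λ r → trans
           (∑-cong (allLinMaps u d) λ h → ⟦∷≡∷⟧ (dot r s) (dot r t) (apply h s) (apply h t))
           (∑-*ˡ (allLinMaps u d) ⟦ dot r s ≡ᵇ dot r t ⟧ _)) ⟩
    2 ^ suc d * ∑𝔽 u (λ r → ⟦ dot r s ≡ᵇ dot r t ⟧ * collisions s t d)
      ≡⟨ cong (2 ^ suc d *_) (∑-*ʳ (all𝔽₂^ u) (collisions s t d) _) ⟩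
    2 * 2 ^ d * (agree s t * collisions s t d)
      ≡⟨ regroup (2 ^ d) (agree s t) (collisions s t d) ⟩
    2 * agree s t * (2 ^ d * collisions s t d)
      ≡⟨ cong₂ _*_ (2*agree s t s≢t) (2^*collisions s t s≢t d) ⟩
    2 ^ u * #L u d
      ≡⟨ #L-suc u d ⟨
    #L u (suc d) ∎
    where
    open ≡-Reasoning
    regroup : ∀ a b c → 2 * a * (b * c) ≡ 2 * b * (a * c)
    regroup = solve-∀

  -- The indicator term covers the diagonal, where every map collides, so that one bound can be
  -- summed over all pairs from `S`.
  collisions-≤ : ∀ (s t : 𝔽₂^ u) d → 2 ^ d * collisions s t d ≤ #L u d * (2 ^ d * ⟦ s ≡ t ⟧ + 1)
  collisions-≤ {u} s t d with s ≟v t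
  ... | no s≢t  = begin
    2 ^ d * collisions s t d      ≡⟨ 2^*collisions s t s≢t d ⟩
    #L u d                        ≡⟨ *-identityʳ _ ⟨
    #L u d * (0 + 1)              ≡⟨ cong (λ z → #L u d * (z + 1)) (*-zeroʳ (2 ^ d)) ⟨
    #L u d * (2 ^ d * 0 + 1)      ∎
    where open ≤-Reasoning
  ... | yes _   = begin
    2 ^ d * collisions s t d      ≤⟨ *-monoʳ-≤ (2 ^ d) (∑-mono (allLinMaps u d) λ h → ind-≤1 (apply h s ≟v apply h t)) ⟩
    2 ^ d * ∑L u d (λ _ → 1)      ≡⟨ cong (2 ^ d *_) (length-∑ (allLinMaps u d)) ⟨
    2 ^ d * #L u d                ≡⟨ *-comm (2 ^ d) _ ⟩
    #L u d * 2 ^ d                ≤⟨ *-monoʳ-≤ (#L u d) (≤-trans (≤-reflexive (sym (*-identityʳ _))) (m≤m+n _ 1)) ⟩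
    #L u d * (2 ^ d * 1 + 1)      ∎
    where open ≤-Reasoning

  -- Distinctness of the elements of `S` enters here: in the second moment, each element then has
  -- only itself as a diagonal partner.
  multiplicity-≤1 : ∀ {S : List (𝔽₂^ u)} → Unique S → ∀ s → ∑ S (λ t → ⟦ t ≡ s ⟧) ≤ 1
  multiplicity-≤1 [] s = z≤n
  multiplicity-≤1 {S = x ∷ S} (x∉S ∷ uniq) s with x ≟v s
  ... | no _     = multiplicity-≤1 uniq s
  ... | yes refl = s≤s (≤-reflexive (absent x∉S))
    where
    absent : ∀ {S} → All (x ≢_) S → ∑ S (λ t → ⟦ t ≡ x ⟧) ≡ 0
    absent []      = refl
    absent {t ∷ _} (x≢t ∷ ps) with t ≟v x
    ... | yes e = contradiction (sym e) x≢t
    ... | no _  = absent ps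

  ∑load² : LinMap u d → List (𝔽₂^ u) → ℕ
  ∑load² {d = d} h S = ∑𝔽 d (λ y → load h S y * load h S y)

  ∑load²≡ : ∀ (h : LinMap u d) S → ∑load² h S ≡ ∑ S (λ s → ∑ S (λ t → ⟦ apply h t ≡ apply h s ⟧))
  ∑load²≡ {d = d} h S = begin
    ∑load² h S                                                ≡⟨ ∑-cong (all𝔽₂^ d) (λ y → sym (∑-*ʳ S (load h S y) _)) ⟩
    ∑𝔽 d (λ y → ∑ S (λ s → ⟦ apply h s ≡ y ⟧ * load h S y))   ≡⟨ ∑-swap (all𝔽₂^ d) S _ ⟩
    ∑ S (λ s → ∑𝔽 d (λ y → ⟦ apply h s ≡ y ⟧ * load h S y))   ≡⟨ ∑-cong S (λ s → ∑𝔽-⟦≡⟧ (apply h s) (load h S)) ⟩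
    ∑ S (λ s → load h S (apply h s))                          ∎
    where open ≡-Reasoning

  -- Squared loads count ordered colliding pairs. The diagonal contributes `m` on average, and all
  -- pairs together another `m² / 2^d`.
  second-moment : ∀ {S : List (𝔽₂^ u)} → Unique S → ∀ d →
    2 ^ d * ∑L u d (λ h → ∑load² h S) ≤ #L u d * (length S * 2 ^ d + length S * length S)
  second-moment {u} {S} uniq d = begin
    2 ^ d * ∑L u d (λ h → ∑load² h S)
      ≡⟨ cong (2 ^ d *_) (trans (∑-cong (allLinMaps u d) λ h → ∑load²≡ h S) (trans (∑-swap (allLinMaps u d) S _)
           (∑-cong S λ s → ∑-swap (allLinMaps u d) S _))) ⟩
    2 ^ d * ∑ S (λ s → ∑ S (λ t → collisions t s d))
      ≡⟨ ∑-*ˡ S (2 ^ d) _ ⟨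
    ∑ S (λ s → 2 ^ d * ∑ S (λ t → collisions t s d))
      ≤⟨ ∑-mono S row ⟩
    ∑ S (λ s → #L u d * (2 ^ d + length S))
      ≡⟨ ∑-const S _ ⟩
    length S * (#L u d * (2 ^ d + length S))
      ≡⟨ regroup (length S) (#L u d) (2 ^ d) ⟩
    #L u d * (length S * 2 ^ d + length S * length S) ∎
    where
    open ≤-Reasoning
    regroup : ∀ m a b → m * (a * (b + m)) ≡ a * (m * b + m * m)
    regroup = solve-∀
    row : ∀ s → 2 ^ d * ∑ S (λ t → collisions t s d) ≤ #L u d * (2 ^ d + length S)
    row s = begin
      2 ^ d * ∑ S (λ t → collisions t s d)
        ≡⟨ ∑-*ˡ S (2 ^ d) _ ⟨
      ∑ S (λ t → 2 ^ d * collisions t s d)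
        ≤⟨ ∑-mono S (λ t → collisions-≤ t s d) ⟩
      ∑ S (λ t → #L u d * (2 ^ d * ⟦ t ≡ s ⟧ + 1))
        ≡⟨ ∑-*ˡ S (#L u d) _ ⟩
      #L u d * ∑ S (λ t → 2 ^ d * ⟦ t ≡ s ⟧ + 1)
        ≡⟨ cong (#L u d *_) (trans (∑-+ S _ _) (cong₂ _+_ (∑-*ˡ S (2 ^ d) _) (sym (length-∑ S)))) ⟩
      #L u d * (2 ^ d * ∑ S (λ t → ⟦ t ≡ s ⟧) + length S)
        ≤⟨ *-monoʳ-≤ (#L u d) (+-monoˡ-≤ (length S) (≤-trans (*-monoʳ-≤ (2 ^ d) (multiplicity-≤1 uniq s)) (≤-reflexive (*-identityʳ _)))) ⟩
      #L u d * (2 ^ d + length S) ∎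

  -- Merging bins

  -- Turns a polynomial inequality into an identity for the ring solver once the difference `s` is
  -- written out.
  ≤-slack : ∀ {a b} s → a + s ≡ b → a ≤ b
  ≤-slack s refl = m≤m+n _ s

  4ab≤[a+b]² : ∀ a b → 4 * (a * b) ≤ (a + b) * (a + b)
  4ab≤[a+b]² a b with ≤-total a b
  ... | inj₁ a≤b with k , refl ← m≤n⇒∃[o]m+o≡n a≤b = ≤-slack (k * k) (eq a k)
    where
    eq : ∀ a k → 4 * (a * (a + k)) + k * k ≡ (a + (a + k)) * (a + (a + k))
    eq = solve-∀
  ... | inj₂ b≤a with k , refl ← m≤n⇒∃[o]m+o≡n b≤a = ≤-slack (k * k) (eq b k)
    where
    eq : ∀ b k → 4 * ((b + k) * b) + k * k ≡ (b + k + b) * (b + k + b)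
    eq = solve-∀

  2ab≤a²+b² : ∀ a b → 2 * (a * b) ≤ a * a + b * b
  2ab≤a²+b² a b = +-cancelʳ-≤ (2 * (a * b)) _ _ (begin
    2 * (a * b) + 2 * (a * b)      ≡⟨ eq₁ a b ⟩
    4 * (a * b)                    ≤⟨ 4ab≤[a+b]² a b ⟩
    (a + b) * (a + b)              ≡⟨ eq₂ a b ⟩
    a * a + b * b + 2 * (a * b)    ∎)
    where
    open ≤-Reasoning
    eq₁ : ∀ a b → 2 * (a * b) + 2 * (a * b) ≡ 4 * (a * b)
    eq₁ = solve-∀
    eq₂ : ∀ a b → (a + b) * (a + b) ≡ a * a + b * b + 2 * (a * b)
    eq₂ = solve-∀

  -- exc k = 2 ^ k ∸ (1 + k), which vanishes for the loads 0 and 1.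
  exc : ℕ → ℕ
  exc zero    = 0
  exc (suc k) = 2 * exc k + k

  2^≡1+k+exc : ∀ k → 2 ^ k ≡ 1 + k + exc k
  2^≡1+k+exc zero    = refl
  2^≡1+k+exc (suc k) = trans (cong (2 *_) (2^≡1+k+exc k)) (eq k (exc k))
    where
    eq : ∀ k e → 2 * (1 + k + e) ≡ 1 + suc k + (2 * e + k)
    eq = solve-∀

  -- Since `k + exc k` is `2 ^ k ∸ 1`, this is `xy - 1 = (x - 1) + (y - 1) + (x - 1)(y - 1)` for `x
  -- = 2^a` and `y = 2^b`, with `a + b` removed from both sides.
  exc-+ : ∀ a b → exc (a + b) ≡ exc a + exc b + (a + exc a) * (b + exc b)
  exc-+ zero    b = sym (+-identityʳ _)
  exc-+ (suc a) b = trans (cong (λ e → 2 * e + (a + b)) (exc-+ a b)) (eq a b (exc a) (exc b))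
    where
    eq : ∀ a b x y → 2 * (x + y + (a + x) * (b + y)) + (a + b) ≡ 2 * x + a + y + (suc a + (2 * x + a)) * (b + y)
    eq = solve-∀

  excess : (𝔽₂^ d → ℕ) → ℕ
  excess {d} φ = ∑𝔽 d (λ y → exc (φ y))

  -- By `∑𝔽-convolution` the cross terms of `exc-+` sum to a product over the two halves. AM-GM,
  -- applied first to the halves and then to total load and total excess, leaves only squares of
  -- totals.
  ∑-excess-merge : ∀ (φ : 𝔽₂^ (suc d) → ℕ) →
    2 * ∑𝔽 d (λ w → excess (merge w φ)) ≤
    2 * (2 ^ d * excess φ) + (∑𝔽 (suc d) φ * ∑𝔽 (suc d) φ + excess φ * excess φ)
  ∑-excess-merge {d} φ = begin
    2 * ∑𝔽 d (λ w → excess (merge w φ))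
      ≡⟨ cong (2 *_) total ⟩
    2 * (2 ^ d * Y₀ + 2 ^ d * Y₁ + (m₀ + Y₀) * (m₁ + Y₁))
      ≤⟨ bound (2 ^ d) m₀ m₁ Y₀ Y₁ ⟩
    2 * (2 ^ d * (Y₀ + Y₁)) + ((m₀ + m₁) * (m₀ + m₁) + (Y₀ + Y₁) * (Y₀ + Y₁))
      ≡⟨ cong₂ (λ Y m → 2 * (2 ^ d * Y) + (m * m + Y * Y)) (∑𝔽-suc d _) (∑𝔽-suc d φ) ⟨
    2 * (2 ^ d * excess φ) + (∑𝔽 (suc d) φ * ∑𝔽 (suc d) φ + excess φ * excess φ) ∎
    where
    open ≤-Reasoning
    φ₀ φ₁ : 𝔽₂^ d → ℕ
    φ₀ y = φ (false ∷ y)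
    φ₁ y = φ (true ∷ y)
    m₀ = ∑𝔽 d φ₀
    m₁ = ∑𝔽 d φ₁
    Y₀ = excess φ₀
    Y₁ = excess φ₁
    total : ∑𝔽 d (λ w → excess (merge w φ)) ≡ 2 ^ d * Y₀ + 2 ^ d * Y₁ + (m₀ + Y₀) * (m₁ + Y₁)
    total = ≡R.begin
      ∑𝔽 d (λ w → excess (merge w φ))
        ≡R.≡⟨ ∑-cong (all𝔽₂^ d) (λ w → trans (∑-cong (all𝔽₂^ d) (λ y → exc-+ (φ₀ y) (φ₁ (y ⊕ w))))
                (trans (∑-+ (all𝔽₂^ d) _ _) (cong (_+ cross w) (trans (∑-+ (all𝔽₂^ d) _ _) (cong (Y₀ +_) (∑𝔽-⊕ w (λ y → exc (φ₁ y)))))))) ⟩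
      ∑𝔽 d (λ w → Y₀ + Y₁ + cross w)
        ≡R.≡⟨ trans (∑-+ (all𝔽₂^ d) _ _) (cong₂ _+_ (trans (∑𝔽-const d _) (*-distribˡ-+ (2 ^ d) Y₀ Y₁))
                (trans (∑𝔽-convolution d (λ y → φ₀ y + exc (φ₀ y)) (λ y → φ₁ y + exc (φ₁ y)))
                  (cong₂ _*_ (∑-+ (all𝔽₂^ d) _ _) (∑-+ (all𝔽₂^ d) _ _)))) ⟩
      2 ^ d * Y₀ + 2 ^ d * Y₁ + (m₀ + Y₀) * (m₁ + Y₁) ≡R.∎
      where
      module ≡R = ≡-Reasoning
      cross : 𝔽₂^ d → ℕ
      cross w = ∑𝔽 d (λ y → (φ₀ y + exc (φ₀ y)) * (φ₁ (y ⊕ w) + exc (φ₁ (y ⊕ w))))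
    bound : ∀ N a b x y → 2 * (N * x + N * y + (a + x) * (b + y)) ≤ 2 * (N * (x + y)) + ((a + b) * (a + b) + (x + y) * (x + y))
    bound N a b x y = begin
      2 * (N * x + N * y + (a + x) * (b + y))        ≡⟨ eq₁ N x y _ ⟩
      2 * (N * (x + y)) + 2 * ((a + x) * (b + y))    ≤⟨ +-monoʳ-≤ (2 * (N * (x + y))) (*-cancelˡ-≤ 2 cross≤) ⟩
      2 * (N * (x + y)) + ((a + b) * (a + b) + (x + y) * (x + y)) ∎
      where
      eq₁ : ∀ N x y q → 2 * (N * x + N * y + q) ≡ 2 * (N * (x + y)) + 2 * q
      eq₁ = solve-∀
      eq₂ : ∀ a b x y → (a + x + (b + y)) * (a + x + (b + y)) ≡ (a + b) * (a + b) + (x + y) * (x + y) + 2 * ((a + b) * (x + y))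
      eq₂ = solve-∀
      eq₃ : ∀ p → p + p ≡ 2 * p
      eq₃ = solve-∀
      cross≤ : 2 * (2 * ((a + x) * (b + y))) ≤ 2 * ((a + b) * (a + b) + (x + y) * (x + y))
      cross≤ = begin
        2 * (2 * ((a + x) * (b + y)))                     ≡⟨ *-assoc 2 2 ((a + x) * (b + y)) ⟨
        4 * ((a + x) * (b + y))                           ≤⟨ 4ab≤[a+b]² (a + x) (b + y) ⟩
        (a + x + (b + y)) * (a + x + (b + y))             ≡⟨ eq₂ a b x y ⟩
        (a + b) * (a + b) + (x + y) * (x + y) + 2 * ((a + b) * (x + y))
          ≤⟨ +-monoʳ-≤ ((a + b) * (a + b) + (x + y) * (x + y)) (2ab≤a²+b² (a + b) (x + y)) ⟩
        (a + b) * (a + b) + (x + y) * (x + y) + ((a + b) * (a + b) + (x + y) * (x + y))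
          ≡⟨ eq₃ ((a + b) * (a + b) + (x + y) * (x + y)) ⟩
        2 * ((a + b) * (a + b) + (x + y) * (x + y)) ∎

  -- The sum of `2^(−φ y)`, multiplied by `2 ^ m` to stay in ℕ; the loads are at most `m` in all
  -- uses, so the truncated subtraction is exact there.
  deficit : ℕ → (𝔽₂^ d → ℕ) → ℕ
  deficit {d} m φ = ∑𝔽 d (λ y → 2 ^ (m ∸ φ y))

  -- `2^(−f)` turns a sum of loads into a product, so the sum over `w` factorises into two half
  -- sums, and AM-GM bounds their product by a quarter of the square of the whole. The factor
  -- `2 ^ m` on the left balances the two scalings on the right.
  ∑-deficit-merge : ∀ m (φ : 𝔽₂^ (suc d) → ℕ) → (∀ w y → merge w φ y ≤ m) →
    4 * (2 ^ m * ∑𝔽 d (λ w → deficit m (merge w φ))) ≤ deficit m φ * deficit m φ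
  ∑-deficit-merge {d} m φ φ≤m = begin
    4 * (2 ^ m * ∑𝔽 d (λ w → deficit m (merge w φ)))     ≡⟨ cong (4 *_) total ⟩
    4 * (G₀ * G₁)                                        ≤⟨ 4ab≤[a+b]² G₀ G₁ ⟩
    (G₀ + G₁) * (G₀ + G₁)                                ≡⟨ cong (λ G → G * G) (∑𝔽-suc d _) ⟨
    deficit m φ * deficit m φ                            ∎
    where
    open ≤-Reasoning
    g₀ g₁ : 𝔽₂^ d → ℕ
    g₀ y = 2 ^ (m ∸ φ (false ∷ y))
    g₁ y = 2 ^ (m ∸ φ (true ∷ y))
    G₀ = ∑𝔽 d g₀
    G₁ = ∑𝔽 d g₁
    split : ∀ a b → a + b ≤ m → 2 ^ m * 2 ^ (m ∸ (a + b)) ≡ 2 ^ (m ∸ a) * 2 ^ (m ∸ b)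
    split a b le with k , refl ← m≤n⇒∃[o]m+o≡n le = begin-equality
      2 ^ (a + b + k) * 2 ^ (a + b + k ∸ (a + b))              ≡⟨ cong (λ z → 2 ^ (a + b + k) * 2 ^ z) (m+n∸m≡n (a + b) k) ⟩
      2 ^ (a + b + k) * 2 ^ k                                  ≡⟨ ^-distribˡ-+-* 2 (a + b + k) k ⟨
      2 ^ (a + b + k + k)                                      ≡⟨ cong (2 ^_) (eq a b k) ⟩
      2 ^ (b + k + (a + k))                                    ≡⟨ ^-distribˡ-+-* 2 (b + k) (a + k) ⟩
      2 ^ (b + k) * 2 ^ (a + k)                                ≡⟨ cong₂ (λ x y → 2 ^ x * 2 ^ y) (trans (cong (_∸ a) (+-assoc a b k)) (m+n∸m≡n a (b + k)))
                                                                    (trans (cong (_∸ b) (eq′ a b k)) (m+n∸m≡n b (a + k))) ⟨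
      2 ^ (a + b + k ∸ a) * 2 ^ (a + b + k ∸ b)                ∎
      where
      eq : ∀ a b k → a + b + k + k ≡ b + k + (a + k)
      eq = solve-∀
      eq′ : ∀ a b k → a + b + k ≡ b + (a + k)
      eq′ = solve-∀
    total : 2 ^ m * ∑𝔽 d (λ w → deficit m (merge w φ)) ≡ G₀ * G₁
    total = trans (sym (∑-*ˡ (all𝔽₂^ d) (2 ^ m) _)) (trans
      (∑-cong (all𝔽₂^ d) λ w → trans (sym (∑-*ˡ (all𝔽₂^ d) (2 ^ m) _))
        (∑-cong (all𝔽₂^ d) λ y → split (φ (false ∷ y)) (φ (true ∷ (y ⊕ w))) (φ≤m w y)))
      (∑𝔽-convolution d g₀ g₁))

  -- paths β j h / #paths ℓ j is the conditional expectation of β at the end of the chain of reductions from h.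
  module _ {u ℓ : ℕ} (β : LinMap u ℓ → ℕ) where

    paths : ∀ j → LinMap u (j + ℓ) → ℕ
    paths zero    h = β h
    paths (suc j) h = ∑𝔽 (j + ℓ) (λ w → paths j (reduce w h))

  #paths : ℕ → ℕ → ℕ
  #paths ℓ zero    = 1
  #paths ℓ (suc j) = 2 ^ (j + ℓ) * #paths ℓ j

  #paths-nonZero : ∀ ℓ j → NonZero (#paths ℓ j)
  #paths-nonZero ℓ zero    = _
  #paths-nonZero ℓ (suc j) = m*n≢0 (2 ^ (j + ℓ)) (#paths ℓ j) {{m^n≢0 2 (j + ℓ)}} {{#paths-nonZero ℓ j}}

  #L-nonZero : ∀ u d → NonZero (#L u d)
  #L-nonZero u zero    = _
  #L-nonZero u (suc d) = subst NonZero (sym (#L-suc u d)) (m*n≢0 (2 ^ u) (#L u d) {{m^n≢0 2 u}} {{#L-nonZero u d}})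

  module _ {u ℓ : ℕ} (β : LinMap u ℓ → ℕ) where

    paths-≤ : (∀ h → β h ≤ 1) → ∀ j h → paths β j h ≤ #paths ℓ j
    paths-≤ β≤1 zero    h = β≤1 h
    paths-≤ β≤1 (suc j) h = ≤-trans (∑-mono (all𝔽₂^ (j + ℓ)) λ w → paths-≤ β≤1 j (reduce w h))
      (≤-reflexive (∑𝔽-const (j + ℓ) _))

    -- Every reduction preserves uniformity (`∑L-reduce`), so the mean of `β` is the same at both
    -- ends of the chain; denominators are cleared.
    ∑L-paths : ∀ j → ∑L u (j + ℓ) (paths β j) * #L u ℓ ≡ #paths ℓ j * #L u (j + ℓ) * ∑L u ℓ β
    ∑L-paths zero    = eq (∑L u ℓ β) (#L u ℓ)
      where
      eq : ∀ a b → a * b ≡ 1 * b * a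
      eq = solve-∀
    ∑L-paths (suc j) = begin
      ∑L u (suc j + ℓ) (paths β (suc j)) * #L u ℓ
        ≡⟨ cong (_* #L u ℓ) (∑L-reduce u (j + ℓ) (paths β j)) ⟩
      2 ^ u * (2 ^ (j + ℓ) * ∑L u (j + ℓ) (paths β j)) * #L u ℓ
        ≡⟨ eq₁ (2 ^ u) (2 ^ (j + ℓ)) _ _ ⟩
      2 ^ u * 2 ^ (j + ℓ) * (∑L u (j + ℓ) (paths β j) * #L u ℓ)
        ≡⟨ cong (2 ^ u * 2 ^ (j + ℓ) *_) (∑L-paths j) ⟩
      2 ^ u * 2 ^ (j + ℓ) * (#paths ℓ j * #L u (j + ℓ) * ∑L u ℓ β)
        ≡⟨ eq₂ (2 ^ u) (2 ^ (j + ℓ)) (#paths ℓ j) (#L u (j + ℓ)) (∑L u ℓ β) ⟩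
      #paths ℓ (suc j) * (2 ^ u * #L u (j + ℓ)) * ∑L u ℓ β
        ≡⟨ cong (λ z → #paths ℓ (suc j) * z * ∑L u ℓ β) (#L-suc u (j + ℓ)) ⟨
      #paths ℓ (suc j) * #L u (suc j + ℓ) * ∑L u ℓ β ∎
      where
      open ≡-Reasoning
      eq₁ : ∀ a b c e → a * (b * c) * e ≡ a * b * (c * e)
      eq₁ = solve-∀
      eq₂ : ∀ a b p l s → a * b * (p * l * s) ≡ b * p * (a * l) * s
      eq₂ = solve-∀

    -- By `∑L-paths` the two means coincide, so failure may be bounded at dimension `j + ℓ`, where
    -- there are more bins.
    average-paths : ∀ j c → c * ∑L u (j + ℓ) (paths β j) ≤ #paths ℓ j * #L u (j + ℓ) → c * ∑L u ℓ β ≤ #L u ℓ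
    average-paths j c le = *-cancelˡ-≤ (p * l) {{m*n≢0 p l {{#paths-nonZero ℓ j}} {{#L-nonZero u (j + ℓ)}}}} (begin
      p * l * (c * ∑L u ℓ β)                       ≡⟨ eq p l c _ ⟩
      c * (p * l * ∑L u ℓ β)                       ≡⟨ cong (c *_) (∑L-paths j) ⟨
      c * (∑L u (j + ℓ) (paths β j) * #L u ℓ)      ≡⟨ *-assoc c _ _ ⟨
      c * ∑L u (j + ℓ) (paths β j) * #L u ℓ        ≤⟨ *-monoˡ-≤ (#L u ℓ) le ⟩
      p * l * #L u ℓ                               ∎)
      where
      open ≤-Reasoning
      p = #paths ℓ j
      l = #L u (j + ℓ)
      eq : ∀ p l c s → p * l * (c * s) ≡ c * (p * l * s)
      eq = solve-∀

  -- Repeated squares, rounding to powers, and estimates for `exc`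

  tower : ℕ → ℕ
  tower zero    = 2
  tower (suc i) = tower i * tower i

  tower≡2^2^ : ∀ i → tower i ≡ 2 ^ (2 ^ i)
  tower≡2^2^ zero    = refl
  tower≡2^2^ (suc i) = begin
    tower i * tower i            ≡⟨ cong₂ _*_ (tower≡2^2^ i) (tower≡2^2^ i) ⟩
    2 ^ (2 ^ i) * 2 ^ (2 ^ i)    ≡⟨ ^-distribˡ-+-* 2 (2 ^ i) (2 ^ i) ⟨
    2 ^ (2 ^ i + 2 ^ i)          ≡⟨ cong (λ z → 2 ^ (2 ^ i + z)) (+-identityʳ (2 ^ i)) ⟨
    2 ^ (2 ^ suc i)              ∎
    where open ≡-Reasoning

  16≤tower : ∀ i → 16 ≤ tower (2 + i)
  16≤tower zero    = ≤-refl
  16≤tower (suc i) = ≤-trans (m≤n*m 16 16) (*-mono-≤ (16≤tower i) (16≤tower i))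

  n≤2^n : ∀ k → k ≤ 2 ^ k
  n≤2^n k = ≤-trans (≤-trans (n≤1+n k) (m≤m+n (1 + k) (exc k))) (≤-reflexive (sym (2^≡1+k+exc k)))

  -- The first sufficient exponent overshoots by at most a factor `b`. Fuel `c` suffices for the
  -- search because `c ≤ 2 ^ c`.
  power-multiple : ∀ b → 2 ≤ b → ∀ a c → 1 ≤ a → a ≤ c → ∃ λ J → c ≤ a * b ^ J × a * b ^ J ≤ b * c
  power-multiple b 2≤b a c 1≤a a≤c =
    search c 0 (≤-trans (≤-reflexive (*-identityʳ a)) (≤-trans a≤c (m≤n*m c b {{>-nonZero (<⇒≤ 2≤b)}}))) (begin
      c                  ≤⟨ n≤2^n c ⟩
      2 ^ c              ≤⟨ ^-monoˡ-≤ c 2≤b ⟩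
      b ^ c              ≤⟨ m≤n*m (b ^ c) a {{>-nonZero 1≤a}} ⟩
      a * b ^ c          ≡⟨ cong (λ z → a * b ^ z) (+-identityʳ c) ⟨
      a * b ^ (c + 0)    ∎)
    where
    open ≤-Reasoning
    pull : ∀ a b p → a * (b * p) ≡ b * (a * p)
    pull = solve-∀
    search : ∀ fuel J → a * b ^ J ≤ b * c → c ≤ a * b ^ (fuel + J) → ∃ λ J → c ≤ a * b ^ J × a * b ^ J ≤ b * c
    search zero       J small big = J , big , small
    search (suc fuel) J small big with c ≤? a * b ^ J
    ... | yes c≤ = J , c≤ , small
    ... | no c≰  = search fuel (suc J) (≤-trans (≤-reflexive (pull a b (b ^ J))) (*-monoʳ-≤ b (<⇒≤ (≰⇒> c≰))))
                     (≤-trans big (≤-reflexive (cong (λ z → a * b ^ z) (sym (+-suc fuel J)))))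

  1+k≤exc : ∀ k → 1 + (3 + k) ≤ exc (3 + k)
  1+k≤exc zero    = ≤-refl
  1+k≤exc (suc k) = ≤-trans (≤-slack (6 + k + k) (eq k)) (+-monoˡ-≤ (3 + k) (*-monoʳ-≤ 2 (1+k≤exc k)))
    where
    eq : ∀ k → 1 + (3 + suc k) + (6 + k + k) ≡ 2 * (1 + (3 + k)) + (3 + k)
    eq = solve-∀

  -- From 3 on, the subtracted `1 + k` is at most half of `2 ^ k`. This makes a single overfull bin
  -- visible in the excess.
  2^≤2*exc : ∀ {k} → 3 ≤ k → 2 ^ k ≤ 2 * exc k
  2^≤2*exc {k} 3≤k with k′ , refl ← m≤n⇒∃[o]m+o≡n 3≤k = begin
    2 ^ k                   ≡⟨ 2^≡1+k+exc k ⟩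
    1 + k + exc k           ≤⟨ +-monoˡ-≤ (exc k) (1+k≤exc k′) ⟩
    exc k + exc k           ≡⟨ cong (exc k +_) (+-identityʳ (exc k)) ⟨
    2 * exc k               ∎
    where open ≤-Reasoning

  -- Because `exc` vanishes at 0 and 1, it is controlled by `k * (k - 1)`, the number of ordered
  -- colliding pairs. The wasteful factor `2 ^ m` is harmless, since the number of bins may be taken
  -- arbitrarily large.
  exc-≤ : ∀ m {k} → k ≤ m → exc k + 2 ^ m * k ≤ 2 ^ m * (k * k)
  exc-≤ m {zero}        k≤m = ≤-refl
  exc-≤ m {suc zero}    k≤m = ≤-refl
  exc-≤ m {k@(suc (suc k′))} k≤m = begin
    exc k + 2 ^ m * k           ≤⟨ +-monoˡ-≤ (2 ^ m * k) (≤-trans (m≤n+m (exc k) (1 + k)) (≤-reflexive (sym (2^≡1+k+exc k)))) ⟩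
    2 ^ k + 2 ^ m * k           ≤⟨ +-monoˡ-≤ (2 ^ m * k) (^-monoʳ-≤ 2 k≤m) ⟩
    2 ^ m + 2 ^ m * k           ≡⟨ *-suc (2 ^ m) k ⟨
    2 ^ m * suc k               ≤⟨ *-monoʳ-≤ (2 ^ m) (≤-slack (1 + k′ * k′ + 3 * k′) (eq k′)) ⟩
    2 ^ m * (k * k)             ∎
    where
    open ≤-Reasoning
    eq : ∀ k → 3 + k + (1 + k * k + 3 * k) ≡ (2 + k) * (2 + k)
    eq = solve-∀

  -- Undoing a single merge

  ∑𝔽-affine : ∀ d {a b e} (c x : 𝔽₂^ d → ℕ) → (∀ w → a * c w ≤ b * x w + e) → a * ∑𝔽 d c ≤ b * ∑𝔽 d x + 2 ^ d * e
  ∑𝔽-affine d {a} {b} {e} c x le = begin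
    a * ∑𝔽 d c                           ≡⟨ ∑-*ˡ (all𝔽₂^ d) a c ⟨
    ∑𝔽 d (λ w → a * c w)                 ≤⟨ ∑-mono (all𝔽₂^ d) le ⟩
    ∑𝔽 d (λ w → b * x w + e)             ≡⟨ trans (∑-+ (all𝔽₂^ d) _ _) (cong₂ _+_ (∑-*ˡ (all𝔽₂^ d) b x) (∑𝔽-const d e)) ⟩
    b * ∑𝔽 d x + 2 ^ d * e               ∎
    where open ≤-Reasoning

  -- The next two steps propagate bounds p ≤ A (X / N + (m / N)²) and p ≤ A (X / N) + η on the
  -- conditional failure probability p; when X is so large that its square cannot be
  -- absorbed, p ≤ 1 suffices.
  quadratic-step : ∀ r N T c X s m .{{_ : NonZero r}} .{{_ : NonZero N}} → 16 ≤ r →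
    r * r * (N * N) * c ≤ 8 * T * N * s + N * (8 * T * (m * m)) →
    2 * s ≤ 2 * (N * X) + (m * m + X * X) → c ≤ N * T →
    r * (2 * N * (2 * N)) * c ≤ 8 * (N * T) * (2 * N) * X + 8 * (N * T) * (m * m)
  quadratic-step r N T c X s m 16≤r hyp s≤ c≤ with ≤-total (2 * X) (r * N)
  ... | inj₂ rN≤2X = begin
    r * (2 * N * (2 * N)) * c                             ≤⟨ *-monoʳ-≤ (r * (2 * N * (2 * N))) c≤ ⟩
    r * (2 * N * (2 * N)) * (N * T)                       ≡⟨ eq₁ r N T ⟩
    4 * N * N * T * (r * N)                               ≤⟨ *-monoʳ-≤ (4 * N * N * T) rN≤2X ⟩
    4 * N * N * T * (2 * X)                               ≤⟨ ≤-slack (8 * N * N * T * X + 8 * (N * T) * (m * m)) (eq₂ N T X m) ⟩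
    8 * (N * T) * (2 * N) * X + 8 * (N * T) * (m * m)     ∎
    where
    open ≤-Reasoning
    eq₁ : ∀ r N T → r * (2 * N * (2 * N)) * (N * T) ≡ 4 * N * N * T * (r * N)
    eq₁ = solve-∀
    eq₂ : ∀ N T X m → 4 * N * N * T * (2 * X) + (8 * N * N * T * X + 8 * (N * T) * (m * m)) ≡ 8 * (N * T) * (2 * N) * X + 8 * (N * T) * (m * m)
    eq₂ = solve-∀
  ... | inj₁ 2X≤rN = *-cancelˡ-≤ r (begin
    r * (r * (2 * N * (2 * N)) * c)                            ≡⟨ eq₁ r N c ⟩
    4 * (r * r * (N * N) * c)                                  ≤⟨ *-monoʳ-≤ 4 hyp ⟩
    4 * (8 * T * N * s + N * (8 * T * (m * m)))                ≡⟨ eq₂ T N s m ⟩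
    8 * T * N * (2 * (2 * s) + 4 * (m * m))                    ≤⟨ *-monoʳ-≤ (8 * T * N) (begin
        2 * (2 * s) + 4 * (m * m)                                ≤⟨ +-monoˡ-≤ (4 * (m * m)) (*-monoʳ-≤ 2 s≤) ⟩
        2 * (2 * (N * X) + (m * m + X * X)) + 4 * (m * m)        ≡⟨ eq₃ N X m ⟩
        -- `16 ≤ r` absorbs the constants 4 and 6, and the case assumption `2 * X ≤ r * N` makes the
        -- square linear in `X`.
        4 * (N * X) + 2 * X * X + 6 * (m * m)                    ≤⟨ +-mono-≤ (+-mono-≤ (*-monoˡ-≤ (N * X) (≤-trans (m≤m+n 4 12) 16≤r)) (*-monoˡ-≤ X 2X≤rN))
                                                                       (*-monoˡ-≤ (m * m) (≤-trans (m≤m+n 6 10) 16≤r)) ⟩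
        r * (N * X) + r * N * X + r * (m * m)                    ∎) ⟩
    8 * T * N * (r * (N * X) + r * N * X + r * (m * m))        ≡⟨ eq₄ T N r X m ⟩
    r * (8 * (N * T) * (2 * N) * X + 8 * (N * T) * (m * m))    ∎)
    where
    open ≤-Reasoning
    eq₁ : ∀ r N c → r * (r * (2 * N * (2 * N)) * c) ≡ 4 * (r * r * (N * N) * c)
    eq₁ = solve-∀
    eq₂ : ∀ T N s m → 4 * (8 * T * N * s + N * (8 * T * (m * m))) ≡ 8 * T * N * (2 * (2 * s) + 4 * (m * m))
    eq₂ = solve-∀
    eq₃ : ∀ N X m → 2 * (2 * (N * X) + (m * m + X * X)) + 4 * (m * m) ≡ 4 * (N * X) + 2 * X * X + 6 * (m * m)
    eq₃ = solve-∀
    eq₄ : ∀ T N r X m → 8 * T * N * (r * (N * X) + r * N * X + r * (m * m)) ≡ r * (8 * (N * T) * (2 * N) * X + 8 * (N * T) * (m * m))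
    eq₄ = solve-∀

  -- Here M is the value of N at which the linear regime starts, and N = M + K.
  linear-step : ∀ M K T c X s m .{{_ : NonZero (M + K)}} → let N = M + K; K′ = M + 2 * K in
    M * M * N * c ≤ T * M * (M + 3 * K) * s + N * (T * (m * m) * (M + 4 * K)) →
    2 * s ≤ 2 * (N * X) + (m * m + X * X) → c ≤ N * T →
    M * M * (2 * N) * c ≤ N * T * M * (M + 3 * K′) * X + N * T * (m * m) * (M + 4 * K′)
  linear-step M K T c X s m hyp s≤ c≤ with ≤-total ((M + 3 * K) * X) (2 * (M * (M + K)))
  ... | inj₂ large = begin
    M * M * (2 * N) * c                       ≤⟨ *-monoʳ-≤ (M * M * (2 * N)) c≤ ⟩
    M * M * (2 * N) * (N * T)                 ≡⟨ eq₁ M N T ⟩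
    N * T * M * (2 * (M * N))                 ≤⟨ *-monoʳ-≤ (N * T * M) large ⟩
    N * T * M * ((M + 3 * K) * X)             ≤⟨ ≤-slack (N * T * M * (3 * M + 3 * K) * X + N * T * (m * m) * (M + 4 * K′)) (eq₂ M K N T X m) ⟩
    N * T * M * (M + 3 * K′) * X + N * T * (m * m) * (M + 4 * K′) ∎
    where
    open ≤-Reasoning
    N  = M + K
    K′ = M + 2 * K
    eq₁ : ∀ M N T → M * M * (2 * N) * (N * T) ≡ N * T * M * (2 * (M * N))
    eq₁ = solve-∀
    eq₂ : ∀ M K N T X m → N * T * M * ((M + 3 * K) * X) + (N * T * M * (3 * M + 3 * K) * X + N * T * (m * m) * (M + 4 * (M + 2 * K)))
        ≡ N * T * M * (M + 3 * (M + 2 * K)) * X + N * T * (m * m) * (M + 4 * (M + 2 * K))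
    eq₂ = solve-∀
  ... | inj₁ small = begin
    M * M * (2 * N) * c                       ≡⟨ eq₁ M N c ⟩
    2 * (M * M * N * c)                       ≤⟨ *-monoʳ-≤ 2 hyp ⟩
    2 * (T * M * (M + 3 * K) * s + N * (T * (m * m) * (M + 4 * K)))
      ≡⟨ eq₂ T M K s N m ⟩
    T * M * (M + 3 * K) * (2 * s) + 2 * N * (T * (m * m) * (M + 4 * K))
      ≤⟨ +-monoˡ-≤ (2 * N * (T * (m * m) * (M + 4 * K))) (*-monoʳ-≤ (T * M * (M + 3 * K)) s≤) ⟩
    T * M * (M + 3 * K) * (2 * (N * X) + (m * m + X * X)) + 2 * N * (T * (m * m) * (M + 4 * K))
      ≡⟨ eq₃ T M K N X m ⟩
    T * M * (M + 3 * K) * (2 * (N * X)) + T * M * (m * m) * (M + 3 * K) + 2 * N * (T * (m * m) * (M + 4 * K)) + T * M * X * ((M + 3 * K) * X)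
      ≤⟨ +-monoʳ-≤ (T * M * (M + 3 * K) * (2 * (N * X)) + T * M * (m * m) * (M + 3 * K) + 2 * N * (T * (m * m) * (M + 4 * K))) (*-monoʳ-≤ (T * M * X) small) ⟩
    T * M * (M + 3 * K) * (2 * (N * X)) + T * M * (m * m) * (M + 3 * K) + 2 * N * (T * (m * m) * (M + 4 * K)) + T * M * X * (2 * (M * N))
      -- `M + 3 * K′` exceeds twice `M + 3 * K` by `2 * M`, which pays for the linearised square;
      -- `M + 4 * K′` exceeds twice `M + 4 * K` by `3 * M`, which pays for the new `m * m`.
      ≤⟨ ≤-slack (2 * T * M * M * (m * m)) (eq₄ T M K X m) ⟩
    N * T * M * (M + 3 * K′) * X + N * T * (m * m) * (M + 4 * K′) ∎
    where
    open ≤-Reasoning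
    N  = M + K
    K′ = M + 2 * K
    eq₁ : ∀ M N c → M * M * (2 * N) * c ≡ 2 * (M * M * N * c)
    eq₁ = solve-∀
    eq₂ : ∀ T M K s N m → 2 * (T * M * (M + 3 * K) * s + N * (T * (m * m) * (M + 4 * K))) ≡ T * M * (M + 3 * K) * (2 * s) + 2 * N * (T * (m * m) * (M + 4 * K))
    eq₂ = solve-∀
    eq₃ : ∀ T M K N X m → T * M * (M + 3 * K) * (2 * (N * X) + (m * m + X * X)) + 2 * N * (T * (m * m) * (M + 4 * K))
        ≡ T * M * (M + 3 * K) * (2 * (N * X)) + T * M * (m * m) * (M + 3 * K) + 2 * N * (T * (m * m) * (M + 4 * K)) + T * M * X * ((M + 3 * K) * X)
    eq₃ = solve-∀
    eq₄ : ∀ T M K X m → T * M * (M + 3 * K) * (2 * ((M + K) * X)) + T * M * (m * m) * (M + 3 * K) + 2 * (M + K) * (T * (m * m) * (M + 4 * K)) + T * M * X * (2 * (M * (M + K)))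
          + 2 * T * M * M * (m * m)
        ≡ (M + K) * T * M * (M + 3 * (M + 2 * K)) * X + (M + K) * T * (m * m) * (M + 4 * (M + 2 * K))
    eq₄ = solve-∀

  -- min (1 , r² g²) ≤ r g for the normalised deficit g = G / (2 E N).
  squaring-step : ∀ E N T r c G s .{{_ : NonZero E}} →
    E * N * c ≤ T * (r * r) * s → 4 * (E * s) ≤ G * G → c ≤ N * T → E * (2 * N) * c ≤ N * T * r * G
  squaring-step E N T r c G s hyp s≤ c≤ with ≤-total (r * G) (2 * (E * N))
  ... | inj₂ large = begin
    E * (2 * N) * c            ≤⟨ *-monoʳ-≤ (E * (2 * N)) c≤ ⟩
    E * (2 * N) * (N * T)      ≡⟨ eq₁ E N T ⟩
    N * T * (2 * (E * N))      ≤⟨ *-monoʳ-≤ (N * T) large ⟩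
    N * T * (r * G)            ≡⟨ *-assoc (N * T) r G ⟨
    N * T * r * G              ∎
    where
    open ≤-Reasoning
    eq₁ : ∀ E N T → E * (2 * N) * (N * T) ≡ N * T * (2 * (E * N))
    eq₁ = solve-∀
  ... | inj₁ small = *-cancelˡ-≤ (2 * E) {{m*n≢0 2 E}} (begin
    2 * E * (E * (2 * N) * c)            ≡⟨ eq₁ E N c ⟩
    4 * E * (E * N * c)                  ≤⟨ *-monoʳ-≤ (4 * E) hyp ⟩
    4 * E * (T * (r * r) * s)            ≡⟨ eq₂ E T r s ⟩
    T * (r * r) * (4 * (E * s))          ≤⟨ *-monoʳ-≤ (T * (r * r)) s≤ ⟩
    T * (r * r) * (G * G)                ≡⟨ eq₃ T r G ⟩
    T * (r * G) * (r * G)                ≤⟨ *-monoʳ-≤ (T * (r * G)) small ⟩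
    T * (r * G) * (2 * (E * N))          ≡⟨ eq₄ T r G E N ⟩
    2 * E * (N * T * r * G)              ∎)
    where
    open ≤-Reasoning
    eq₁ : ∀ E N c → 2 * E * (E * (2 * N) * c) ≡ 4 * E * (E * N * c)
    eq₁ = solve-∀
    eq₂ : ∀ E T r s → 4 * E * (T * (r * r) * s) ≡ T * (r * r) * (4 * (E * s))
    eq₂ = solve-∀
    eq₃ : ∀ T r G → T * (r * r) * (G * G) ≡ T * (r * G) * (r * G)
    eq₃ = solve-∀
    eq₄ : ∀ T r G E N → T * (r * G) * (2 * (E * N)) ≡ 2 * E * (N * T * r * G)
    eq₄ = solve-∀

  -- Tail bounds

  ∈-all𝔽₂^ : ∀ (y : 𝔽₂^ n) → y ∈ all𝔽₂^ n
  ∈-all𝔽₂^ []          = here refl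
  ∈-all𝔽₂^ (false ∷ y) = ∈-++⁺ˡ (∈-map⁺ (false ∷_) (∈-all𝔽₂^ y))
  ∈-all𝔽₂^ {suc n} (true ∷ y) = ∈-++⁺ʳ (map (false ∷_) (all𝔽₂^ n)) (∈-++⁺ˡ (∈-map⁺ (true ∷_) (∈-all𝔽₂^ y)))

  load-≤ : ∀ (h : LinMap u d) S y → load h S y ≤ length S
  load-≤ h S y = ≤-trans (∑-mono S λ x → ind-≤1 (apply h x ≟v y)) (≤-reflexive (sym (length-∑ S)))

  double-+ : ∀ a b → 2 * (a + b) ≡ a + (a + 2 * b)
  double-+ = solve-∀

  module Tails {u} (S : List (𝔽₂^ u)) (uniq : Unique S) (1≤m : 1 ≤ length S) where

    m : ℕ
    m = length S

    X G : LinMap u d → ℕ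
    X h = excess (load h S)
    G h = deficit m (load h S)

    ∑X-reduce : ∀ (h : LinMap u (suc d)) →
      2 * ∑𝔽 d (λ w → X (reduce w h)) ≤ 2 * (2 ^ d * X h) + (m * m + X h * X h)
    ∑X-reduce {d} h = begin
      2 * ∑𝔽 d (λ w → X (reduce w h))
        ≡⟨ cong (2 *_) (∑-cong (all𝔽₂^ d) λ w → ∑-cong (all𝔽₂^ d) λ y → cong exc (load-reduce w h S y)) ⟩
      2 * ∑𝔽 d (λ w → excess (merge w (load h S)))
        ≤⟨ ∑-excess-merge (load h S) ⟩
      2 * (2 ^ d * X h) + (∑𝔽 (suc d) (load h S) * ∑𝔽 (suc d) (load h S) + X h * X h)
        ≡⟨ cong (λ z → 2 * (2 ^ d * X h) + (z * z + X h * X h)) (∑-load h S) ⟩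
      2 * (2 ^ d * X h) + (m * m + X h * X h) ∎
      where open ≤-Reasoning

    ∑G-reduce : ∀ (h : LinMap u (suc d)) → 4 * (2 ^ m * ∑𝔽 d (λ w → G (reduce w h))) ≤ G h * G h
    ∑G-reduce {d} h = begin
      4 * (2 ^ m * ∑𝔽 d (λ w → G (reduce w h)))
        ≡⟨ cong (λ z → 4 * (2 ^ m * z)) (∑-cong (all𝔽₂^ d) λ w → ∑-cong (all𝔽₂^ d) λ y → cong (λ z → 2 ^ (m ∸ z)) (load-reduce w h S y)) ⟩
      4 * (2 ^ m * ∑𝔽 d (λ w → deficit m (merge w (load h S))))
        ≤⟨ ∑-deficit-merge m (load h S) (λ w y → ≤-trans (≤-reflexive (sym (load-reduce w h S y))) (load-≤ (reduce w h) S y)) ⟩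
      G h * G h ∎
      where open ≤-Reasoning

    -- The diagonal part of `second-moment` cancels against the linear term of `exc-≤`, leaving
    -- `m * m`. For fixed `S` the mean of `X` thus decays like `2^(−d)`.
    ∑L-X : ∀ d → 2 ^ d * ∑L u d X ≤ 2 ^ m * (m * m) * #L u d
    ∑L-X d = +-cancelʳ-≤ (2 ^ d * (2 ^ m * m * #L u d)) _ _ (begin
      2 ^ d * ∑L u d X + 2 ^ d * (2 ^ m * m * #L u d)
        ≡⟨ *-distribˡ-+ (2 ^ d) (∑L u d X) _ ⟨
      2 ^ d * (∑L u d X + 2 ^ m * m * #L u d)
        ≡⟨ cong (λ z → 2 ^ d * (∑L u d X + z)) (trans (*-comm (2 ^ m * m) (#L u d)) (sym (∑-const (allLinMaps u d) (2 ^ m * m)))) ⟩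
      2 ^ d * (∑L u d X + ∑L u d (λ _ → 2 ^ m * m))
        ≡⟨ cong (2 ^ d *_) (∑-+ (allLinMaps u d) X _) ⟨
      2 ^ d * ∑L u d (λ h → X h + 2 ^ m * m)
        ≤⟨ *-monoʳ-≤ (2 ^ d) (∑-mono (allLinMaps u d) each) ⟩
      2 ^ d * ∑L u d (λ h → 2 ^ m * ∑load² h S)
        ≡⟨ cong (2 ^ d *_) (∑-*ˡ (allLinMaps u d) (2 ^ m) _) ⟩
      2 ^ d * (2 ^ m * ∑L u d (λ h → ∑load² h S))
        ≡⟨ eq₁ (2 ^ d) (2 ^ m) _ ⟩
      2 ^ m * (2 ^ d * ∑L u d (λ h → ∑load² h S))
        ≤⟨ *-monoʳ-≤ (2 ^ m) (second-moment uniq d) ⟩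
      2 ^ m * (#L u d * (m * 2 ^ d + m * m))
        ≡⟨ eq₂ (2 ^ m) (#L u d) m (2 ^ d) ⟩
      2 ^ m * (m * m) * #L u d + 2 ^ d * (2 ^ m * m * #L u d) ∎)
      where
      open ≤-Reasoning
      eq₁ : ∀ a b c → a * (b * c) ≡ b * (a * c)
      eq₁ = solve-∀
      eq₂ : ∀ e l m n → e * (l * (m * n + m * m)) ≡ e * (m * m) * l + n * (e * m * l)
      eq₂ = solve-∀
      each : ∀ h → X h + 2 ^ m * m ≤ 2 ^ m * ∑load² h S
      each h = begin
        X h + 2 ^ m * m
          ≡⟨ cong (λ z → X h + 2 ^ m * z) (∑-load h S) ⟨
        X h + 2 ^ m * ∑𝔽 d (load h S)
          ≡⟨ cong (X h +_) (∑-*ˡ (all𝔽₂^ d) (2 ^ m) _) ⟨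
        X h + ∑𝔽 d (λ y → 2 ^ m * load h S y)
          ≡⟨ ∑-+ (all𝔽₂^ d) _ _ ⟨
        ∑𝔽 d (λ y → exc (load h S y) + 2 ^ m * load h S y)
          ≤⟨ ∑-mono (all𝔽₂^ d) (λ y → exc-≤ m (load-≤ h S y)) ⟩
        ∑𝔽 d (λ y → 2 ^ m * (load h S y * load h S y))
          ≡⟨ ∑-*ˡ (all𝔽₂^ d) (2 ^ m) _ ⟩
        2 ^ m * ∑load² h S ∎

    -- Multiplied by 1 + k, this is k (M (1 + k) − m)² ≥ 0 combined with 2⁻ᵏ ≤ 1 / (1 + k).
    2^-quadratic : ∀ M {k} → k ≤ m →
      m * m * 2 ^ (m ∸ k) + 2 ^ m * (2 * M * m) * k ≤ 2 ^ m * (m * m) + 2 ^ m * (M * M) * (k + k * k)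
    2^-quadratic M {k} k≤m = *-cancelˡ-≤ (suc k) (+-cancelʳ-≤ (2 ^ m * k * (2 * (M * suc k * m))) _ _ (begin
      suc k * (m * m * 2 ^ (m ∸ k) + 2 ^ m * (2 * M * m) * k) + 2 ^ m * k * (2 * (M * suc k * m))
        ≡⟨ eq₁ k m (2 ^ (m ∸ k)) (2 ^ m) M ⟩
      m * m * (suc k * 2 ^ (m ∸ k)) + 2 ^ m * (2 * M * m) * k * suc k + 2 ^ m * k * (2 * (M * suc k * m))
        ≤⟨ +-mono-≤ (+-monoˡ-≤ (2 ^ m * (2 * M * m) * k * suc k) (*-monoʳ-≤ (m * m) weight)) (*-monoʳ-≤ (2 ^ m * k) (2ab≤a²+b² (M * suc k) m)) ⟩
      m * m * 2 ^ m + 2 ^ m * (2 * M * m) * k * suc k + 2 ^ m * k * (M * suc k * (M * suc k) + m * m)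
        ≡⟨ eq₂ k m (2 ^ m) M ⟩
      suc k * (2 ^ m * (m * m) + 2 ^ m * (M * M) * (k + k * k)) + 2 ^ m * k * (2 * (M * suc k * m)) ∎))
      where
      open ≤-Reasoning
      weight : suc k * 2 ^ (m ∸ k) ≤ 2 ^ m
      weight = begin
        suc k * 2 ^ (m ∸ k)    ≤⟨ *-monoˡ-≤ (2 ^ (m ∸ k)) (≤-trans (m≤m+n (suc k) (exc k)) (≤-reflexive (sym (2^≡1+k+exc k)))) ⟩
        2 ^ k * 2 ^ (m ∸ k)    ≡⟨ ^-distribˡ-+-* 2 k (m ∸ k) ⟨
        2 ^ (k + (m ∸ k))      ≡⟨ cong (2 ^_) (m+[n∸m]≡n k≤m) ⟩
        2 ^ m                  ∎
      eq₁ : ∀ k m g e M → suc k * (m * m * g + e * (2 * M * m) * k) + e * k * (2 * (M * suc k * m))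
          ≡ m * m * (suc k * g) + e * (2 * M * m) * k * suc k + e * k * (2 * (M * suc k * m))
      eq₁ = solve-∀
      eq₂ : ∀ k m e M → m * m * e + e * (2 * M * m) * k * suc k + e * k * (M * suc k * (M * suc k) + m * m)
          ≡ suc k * (e * (m * m) + e * (M * M) * (k + k * k)) + e * k * (2 * (M * suc k * m))
      eq₂ = solve-∀

    -- Taking the number of bins for `M` in `2^-quadratic` centres that bound near the mean load.
    -- After summation the second moment is the only random quantity on the right.
    G-quadratic : ∀ (h : LinMap u d) → let M = 2 ^ d in
      m * m * G h + 2 ^ m * (M * (m * m)) ≤ 2 ^ m * (M * M * m) + 2 ^ m * (M * M) * ∑load² h S
    G-quadratic {d} h = +-cancelʳ-≤ (2 ^ m * (M * (m * m))) _ _ (begin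
      m * m * G h + 2 ^ m * (M * (m * m)) + 2 ^ m * (M * (m * m))
        ≡⟨ eq₁ m (G h) (2 ^ m) M ⟩
      m * m * G h + 2 ^ m * (2 * M * m) * m
        ≡⟨ cong (λ z → m * m * G h + 2 ^ m * (2 * M * m) * z) (∑-load h S) ⟨
      m * m * G h + 2 ^ m * (2 * M * m) * ∑𝔽 d f
        ≡⟨ trans (∑-+ (all𝔽₂^ d) _ _) (cong₂ _+_ (∑-*ˡ (all𝔽₂^ d) (m * m) _) (∑-*ˡ (all𝔽₂^ d) (2 ^ m * (2 * M * m)) f)) ⟨
      ∑𝔽 d (λ y → m * m * 2 ^ (m ∸ f y) + 2 ^ m * (2 * M * m) * f y)
        ≤⟨ ∑-mono (all𝔽₂^ d) (λ y → 2^-quadratic M (load-≤ h S y)) ⟩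
      ∑𝔽 d (λ y → 2 ^ m * (m * m) + 2 ^ m * (M * M) * (f y + f y * f y))
        ≡⟨ trans (∑-+ (all𝔽₂^ d) _ _) (cong₂ _+_ (∑𝔽-const d _) (trans (∑-*ˡ (all𝔽₂^ d) (2 ^ m * (M * M)) _)
             (cong (2 ^ m * (M * M) *_) (trans (∑-+ (all𝔽₂^ d) _ _) (cong (_+ ∑load² h S) (∑-load h S)))))) ⟩
      M * (2 ^ m * (m * m)) + 2 ^ m * (M * M) * (m + ∑load² h S)
        ≡⟨ eq₂ M (2 ^ m) m (∑load² h S) ⟩
      2 ^ m * (M * M * m) + 2 ^ m * (M * M) * ∑load² h S + 2 ^ m * (M * (m * m)) ∎)
      where
      open ≤-Reasoning
      M = 2 ^ d
      f = load h S
      eq₁ : ∀ m g e M → m * m * g + e * (M * (m * m)) + e * (M * (m * m)) ≡ m * m * g + e * (2 * M * m) * m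
      eq₁ = solve-∀
      eq₂ : ∀ M e m q → M * (e * (m * m)) + e * (M * M) * (m + q) ≡ e * (M * M * m) + e * (M * M) * q + e * (M * (m * m))
      eq₂ = solve-∀

    -- The `m * m` part of `second-moment` cancels against the term added to the left of
    -- `G-quadratic`; two equal terms remain and give the factor 2.
    ∑L-G : ∀ d → m * ∑L u d G ≤ 2 * (2 ^ m * (2 ^ d * 2 ^ d)) * #L u d
    ∑L-G d = *-cancelˡ-≤ m {{>-nonZero 1≤m}} (+-cancelʳ-≤ (2 ^ m * (M * (m * m)) * L) _ _ (begin
      m * (m * ∑L u d G) + 2 ^ m * (M * (m * m)) * L
        ≡⟨ cong₂ _+_ (trans (sym (*-assoc m m _)) (sym (∑-*ˡ (allLinMaps u d) (m * m) G)))
             (trans (*-comm (2 ^ m * (M * (m * m))) L) (sym (∑-const (allLinMaps u d) _))) ⟩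
      ∑L u d (λ h → m * m * G h) + ∑L u d (λ _ → 2 ^ m * (M * (m * m)))
        ≡⟨ ∑-+ (allLinMaps u d) _ _ ⟨
      ∑L u d (λ h → m * m * G h + 2 ^ m * (M * (m * m)))
        ≤⟨ ∑-mono (allLinMaps u d) G-quadratic ⟩
      ∑L u d (λ h → 2 ^ m * (M * M * m) + 2 ^ m * (M * M) * ∑load² h S)
        ≡⟨ trans (∑-+ (allLinMaps u d) _ _) (cong₂ _+_ (∑-const (allLinMaps u d) _) (∑-*ˡ (allLinMaps u d) (2 ^ m * (M * M)) _)) ⟩
      L * (2 ^ m * (M * M * m)) + 2 ^ m * (M * M) * ∑L u d (λ h → ∑load² h S)
        ≡⟨ eq₁ L (2 ^ m) M m _ ⟩
      L * (2 ^ m * (M * M * m)) + 2 ^ m * M * (M * ∑L u d (λ h → ∑load² h S))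
        ≤⟨ +-monoʳ-≤ (L * (2 ^ m * (M * M * m))) (*-monoʳ-≤ (2 ^ m * M) (second-moment uniq d)) ⟩
      L * (2 ^ m * (M * M * m)) + 2 ^ m * M * (L * (m * M + m * m))
        ≡⟨ eq₂ L (2 ^ m) M m ⟩
      m * (2 * (2 ^ m * (M * M)) * L) + 2 ^ m * (M * (m * m)) * L ∎))
      where
      open ≤-Reasoning
      M = 2 ^ d
      L = #L u d
      eq₁ : ∀ L e M m q → L * (e * (M * M * m)) + e * (M * M) * q ≡ L * (e * (M * M * m)) + e * M * (M * q)
      eq₁ = solve-∀
      eq₂ : ∀ L e M m → L * (e * (M * M * m)) + e * M * (L * (m * M + m * m)) ≡ m * (2 * (e * (M * M)) * L) + e * (M * (m * m)) * L
      eq₂ = solve-∀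

    module _ {ℓ : ℕ} (β : LinMap u ℓ → ℕ) (β≤1 : ∀ h → β h ≤ 1) where

      -- The invariant is `p ≤ (8 / r) (X / N + (m / N)²)` with `r = tower (2 + i)`; each merge
      -- undone replaces `r` by its square root, down to 16 at `i = 0`. The factor 1 in the
      -- hypothesis is `#paths ℓ 0`.
      quadratic-phase : ∀ I →
        (∀ h → tower (2 + I) * (2 ^ ℓ * 2 ^ ℓ) * β h ≤ 8 * 1 * 2 ^ ℓ * X h + 8 * 1 * (m * m)) →
        ∀ j i → j + i ≡ I → ∀ h → let N = 2 ^ (j + ℓ); T = #paths ℓ j in
        tower (2 + i) * (N * N) * paths β j h ≤ 8 * T * N * X h + 8 * T * (m * m)
      quadratic-phase I base zero    i refl h = base h
      quadratic-phase I base (suc j) i refl h =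
        quadratic-step (tower (2 + i)) (2 ^ (j + ℓ)) (#paths ℓ j) (paths β (suc j) h) (X h) _ m
          {{>-nonZero (≤-trans (s≤s z≤n) (16≤tower i))}} {{m^n≢0 2 (j + ℓ)}} (16≤tower i)
          (∑𝔽-affine (j + ℓ) {a = tower (3 + i) * (2 ^ (j + ℓ) * 2 ^ (j + ℓ))} {b = 8 * #paths ℓ j * 2 ^ (j + ℓ)}
            (λ w → paths β j (reduce w h)) (λ w → X (reduce w h)) λ w → quadratic-phase I base j (suc i) (+-suc j i) (reduce w h))
          (∑X-reduce h) (paths-≤ β β≤1 (suc j) h)

      -- For `N = M + K` the invariant is `p ≤ ((M + 3K) / M) (X / N) + (m / M)² (M + 4K) /
      -- N`. The first factor grows linearly in `N`, while the last term stays below `4 (m / M)²`.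
      linear-phase : ∀ I (let M = 2 ^ (I + ℓ)) →
        (∀ h → M * M * paths β I h ≤ #paths ℓ I * (M * X h + m * m)) →
        ∀ k K → M + K ≡ 2 ^ (k + I + ℓ) → ∀ h → let T = #paths ℓ (k + I) in
        M * M * (M + K) * paths β (k + I) h ≤ T * M * (M + 3 * K) * X h + T * (m * m) * (M + 4 * K)
      -- No linear step has been made yet, and the equation forces `K` to be 0.
      linear-phase I base zero K M+K≡ h rewrite +-cancelˡ-≡ (2 ^ (I + ℓ)) K 0 (trans M+K≡ (sym (+-identityʳ _))) = begin
        M * M * (M + 0) * paths β I h                              ≡⟨ eq₁ M (paths β I h) ⟩
        M * (M * M * paths β I h)                                  ≤⟨ *-monoʳ-≤ M (base h) ⟩
        M * (T * (M * X h + m * m))                                ≡⟨ eq₂ M T (X h) m ⟩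
        T * M * (M + 3 * 0) * X h + T * (m * m) * (M + 4 * 0)      ∎
        where
        open ≤-Reasoning
        M = 2 ^ (I + ℓ)
        T = #paths ℓ I
        eq₁ : ∀ M c → M * M * (M + 0) * c ≡ M * (M * M * c)
        eq₁ = solve-∀
        eq₂ : ∀ M T X m → M * (T * (M * X + m * m)) ≡ T * M * (M + 3 * 0) * X + T * (m * m) * (M + 4 * 0)
        eq₂ = solve-∀
      linear-phase I base (suc k) K′ M+K′≡ h
        with K , M+K≡ ← m≤n⇒∃[o]m+o≡n (^-monoʳ-≤ 2 (≤-trans (m≤n+m (I + ℓ) k) (≤-reflexive (sym (+-assoc k I ℓ)))))
        -- Doubling `M + K` gives `M + (M + 2 * K)`, which determines the new `K′`.
        with refl ← +-cancelˡ-≡ (2 ^ (I + ℓ)) K′ (2 ^ (I + ℓ) + 2 * K)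
               (trans M+K′≡ (trans (cong (2 *_) (sym M+K≡)) (double-+ (2 ^ (I + ℓ)) K))) = begin
        M * M * (M + (M + 2 * K)) * c
          ≡⟨ cong (λ z → M * M * z * c) (double-+ M K) ⟨
        M * M * (2 * (M + K)) * c
          ≤⟨ linear-step M K T c (X h) (∑𝔽 (k + I + ℓ) (λ w → X (reduce w h))) m {{subst NonZero (sym M+K≡) (m^n≢0 2 (k + I + ℓ))}}
               (subst (λ z → M * M * (M + K) * c ≤ T * M * (M + 3 * K) * ∑𝔽 (k + I + ℓ) (λ w → X (reduce w h)) + z * (T * (m * m) * (M + 4 * K))) (sym M+K≡)
                 (∑𝔽-affine (k + I + ℓ) {a = M * M * (M + K)} {b = T * M * (M + 3 * K)} (λ w → paths β (k + I) (reduce w h)) (λ w → X (reduce w h)) λ w → linear-phase I base k K M+K≡ (reduce w h)))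
               (subst (λ z → 2 * ∑𝔽 (k + I + ℓ) (λ w → X (reduce w h)) ≤ 2 * (z * X h) + (m * m + X h * X h)) (sym M+K≡) (∑X-reduce h))
               (subst (λ z → c ≤ z * T) (sym M+K≡) (paths-≤ β β≤1 (suc k + I) h)) ⟩
        (M + K) * T * M * (M + 3 * (M + 2 * K)) * X h + (M + K) * T * (m * m) * (M + 4 * (M + 2 * K))
          ≡⟨ cong (λ z → z * T * M * (M + 3 * (M + 2 * K)) * X h + z * T * (m * m) * (M + 4 * (M + 2 * K))) M+K≡ ⟩
        #paths ℓ (suc k + I) * M * (M + 3 * (M + 2 * K)) * X h + #paths ℓ (suc k + I) * (m * m) * (M + 4 * (M + 2 * K)) ∎
        where
        open ≤-Reasoning
        M = 2 ^ (I + ℓ)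
        T = #paths ℓ (k + I)
        c = paths β (suc k + I) h

      -- The invariant is `p ≤ r Ψ` with `r = tower i`; each application of `squaring-step` takes
      -- the square root of `r`, down to 2 at `i = 0`.
      squaring-phase : ∀ J → (∀ h → 2 ^ m * 2 ^ ℓ * β h ≤ 1 * tower J * G h) →
        ∀ j i → j + i ≡ J → ∀ h → 2 ^ m * 2 ^ (j + ℓ) * paths β j h ≤ #paths ℓ j * tower i * G h
      squaring-phase J base zero    i refl h = base h
      squaring-phase J base (suc j) i refl h =
        squaring-step (2 ^ m) (2 ^ (j + ℓ)) (#paths ℓ j) (tower i) (paths β (suc j) h) (G h) (∑𝔽 (j + ℓ) (λ w → G (reduce w h))) {{m^n≢0 2 m}}
          (begin
            2 ^ m * 2 ^ (j + ℓ) * paths β (suc j) h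
              ≡⟨ ∑-*ˡ (all𝔽₂^ (j + ℓ)) (2 ^ m * 2 ^ (j + ℓ)) _ ⟨
            ∑𝔽 (j + ℓ) (λ w → 2 ^ m * 2 ^ (j + ℓ) * paths β j (reduce w h))
              ≤⟨ ∑-mono (all𝔽₂^ (j + ℓ)) (λ w → squaring-phase J base j (suc i) (+-suc j i) (reduce w h)) ⟩
            ∑𝔽 (j + ℓ) (λ w → #paths ℓ j * tower (suc i) * G (reduce w h))
              ≡⟨ ∑-*ˡ (all𝔽₂^ (j + ℓ)) (#paths ℓ j * tower (suc i)) _ ⟩
            #paths ℓ j * tower (suc i) * ∑𝔽 (j + ℓ) (λ w → G (reduce w h)) ∎)
          (∑G-reduce h) (paths-≤ β β≤1 (suc j) h)
        where open ≤-Reasoning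

      -- Two contributions of at most `1 / (4ν²)` each: the accumulated `4 (m / M)²`, and the mean
      -- of `X` at a dimension `D` so large that collisions are rare.
      upper-tail : ∀ ν → 1 ≤ ν → 1 ≤ ℓ → 2 ^ ℓ * ℓ ≤ m →
        (∀ h → β h ≡ 0 ⊎ ∃ λ y → 33 * ν * m < load h S y * 2 ^ ℓ) → 2 * (ν * ν) * ∑L u ℓ β ≤ #L u ℓ
      upper-tail ν 1≤ν 1≤ℓ nℓ≤m overfull = average-paths β (k + I) (2 * (ν * ν))
        (*-cancelˡ-≤ (2 * (M * M)) {{m*n≢0 2 (M * M) {{_}} {{m*n≢0 M M}}}} (begin
          2 * (M * M) * (2 * (ν * ν) * C)              ≡⟨ eq₁ M ν C ⟩
          4 * (ν * ν) * (M * M * C)                    ≤⟨ *-monoʳ-≤ (4 * (ν * ν)) averaged ⟩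
          4 * (ν * ν) * (3 * T * M * Y + 4 * T * (m * m) * L)
                                                       ≡⟨ eq₂ ν T M Y m L ⟩
          T * M * (12 * (ν * ν) * Y) + T * L * (4 * ν * m * (4 * ν * m))
                                                       ≤⟨ +-mono-≤ (*-monoʳ-≤ (T * M) few-collisions) (*-monoʳ-≤ (T * L) (*-mono-≤ 4νm≤M 4νm≤M)) ⟩
          T * M * L + T * L * (M * M)                  ≤⟨ +-monoˡ-≤ (T * L * (M * M)) (*-monoˡ-≤ L (*-monoʳ-≤ T (m≤m*n M M))) ⟩
          T * (M * M) * L + T * L * (M * M)            ≡⟨ eq₃ T M L ⟩
          2 * (M * M) * (T * L)                        ∎))
        where
        open ≤-Reasoning
        bins = 2 ^ ℓ
        n≤m : bins ≤ m
        n≤m = ≤-trans (≤-trans (≤-reflexive (sym (*-identityʳ bins))) (*-monoʳ-≤ bins 1≤ℓ)) nℓ≤m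
        m≤νm : m ≤ ν * m
        m≤νm = m≤n*m m ν {{>-nonZero 1≤ν}}
        -- This places `M` between `4 * ν * m` and `8 * ν * m`. The lower bound makes `4 (m / M)²`
        -- small enough; the upper bound keeps `2 ^ (2 + I)` below the load of an overfull bin.
        scale = power-multiple 2 ≤-refl bins (4 * ν * m) (m^n>0 2 ℓ)
          (≤-trans n≤m (≤-trans m≤νm (≤-trans (m≤n*m (ν * m) 4) (≤-reflexive (sym (*-assoc 4 ν m))))))
        I = proj₁ scale
        M = 2 ^ (I + ℓ)
        instance
          M≢0 : NonZero M
          M≢0 = m^n≢0 2 (I + ℓ)
        M≡ : M ≡ bins * 2 ^ I
        M≡ = trans (^-distribˡ-+-* 2 I ℓ) (*-comm (2 ^ I) bins)
        4νm≤M : 4 * ν * m ≤ M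
        4νm≤M = ≤-trans (proj₁ (proj₂ scale)) (≤-reflexive (sym M≡))
        -- Chosen so that `2 ^ k ≥ k` beats the bound of `∑L-X`; 12 is the 3 of `pointwise` times
        -- the 4 of the final estimate.
        k = 12 * (ν * ν) * (2 ^ m * (m * m))
        D = k + I + ℓ
        T = #paths ℓ (k + I)
        L = #L u D
        Y = ∑L u D X
        C = ∑L u D (paths β (k + I))
        base : ∀ h → tower (2 + I) * (bins * bins) * β h ≤ 8 * 1 * bins * X h + 8 * 1 * (m * m)
        base h with overfull h
        ... | inj₁ β≡0 = ≤-trans (≤-reflexive (trans (cong (tower (2 + I) * (bins * bins) *_) β≡0) (*-zeroʳ (tower (2 + I) * (bins * bins))))) z≤n
        ... | inj₂ (y , over) = begin
          tower (2 + I) * (bins * bins) * β h      ≤⟨ *-monoʳ-≤ (tower (2 + I) * (bins * bins)) (β≤1 h) ⟩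
          tower (2 + I) * (bins * bins) * 1        ≡⟨ eq₄ (tower (2 + I)) bins ⟩
          bins * (tower (2 + I) * bins)            ≡⟨ cong (λ z → bins * (z * bins)) (tower≡2^2^ (2 + I)) ⟩
          bins * (2 ^ (2 ^ (2 + I)) * bins)        ≡⟨ cong (bins *_) (^-distribˡ-+-* 2 (2 ^ (2 + I)) ℓ) ⟨
          bins * 2 ^ (2 ^ (2 + I) + ℓ)          ≤⟨ *-monoʳ-≤ bins (^-monoʳ-≤ 2 (<⇒≤ big)) ⟩
          bins * 2 ^ f                          ≤⟨ *-monoʳ-≤ bins (2^≤2*exc 3≤f) ⟩
          bins * (2 * exc f)                    ≤⟨ *-monoʳ-≤ bins (*-monoʳ-≤ 2 (∑-∈ (λ y → exc (load h S y)) (∈-all𝔽₂^ y))) ⟩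
          bins * (2 * X h)                      ≤⟨ ≤-slack (6 * bins * X h + 8 * (m * m)) (eq₅ bins (X h) m) ⟩
          8 * 1 * bins * X h + 8 * 1 * (m * m)  ∎
          where
          f = load h S y
          eq₄ : ∀ t bins → t * (bins * bins) * 1 ≡ bins * (t * bins)
          eq₄ = solve-∀
          eq₅ : ∀ bins x m → bins * (2 * x) + (6 * bins * x + 8 * (m * m)) ≡ 8 * 1 * bins * x + 8 * 1 * (m * m)
          eq₅ = solve-∀
          eq₆ : ∀ p bins l → (2 * (2 * p) + l) * bins ≡ 4 * (bins * p) + bins * l
          eq₆ = solve-∀
          eq₇ : ∀ ν m → 4 * (2 * (4 * ν * m)) + ν * m ≡ 33 * ν * m
          eq₇ = solve-∀
          -- 33 is 32 + 1: after multiplication by `bins`, the term `2 ^ (2 + I)` costs at most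
          -- `32 * ν * m` and `ℓ` at most `ν * m`. The summand `ℓ` supplies a factor `bins` in
          -- `2 ^ f`.
          big : 2 ^ (2 + I) + ℓ < f
          big = *-cancelʳ-< bins _ _ (≤-<-trans (begin
            (2 ^ (2 + I) + ℓ) * bins              ≡⟨ eq₆ (2 ^ I) bins ℓ ⟩
            4 * (bins * 2 ^ I) + bins * ℓ            ≤⟨ +-mono-≤ (*-monoʳ-≤ 4 (proj₂ (proj₂ scale))) (≤-trans nℓ≤m m≤νm) ⟩
            4 * (2 * (4 * ν * m)) + ν * m      ≡⟨ eq₇ ν m ⟩
            33 * ν * m                         ∎) over)
          3≤f : 3 ≤ f
          3≤f = ≤-trans (≤-trans (s≤s (s≤s (s≤s z≤n))) (≤-trans (^-monoʳ-≤ 2 (m≤m+n 2 I)) (m≤m+n _ ℓ))) (<⇒≤ big)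
        quadratic-end : ∀ h → M * M * paths β I h ≤ #paths ℓ I * (M * X h + m * m)
        quadratic-end h = *-cancelˡ-≤ 16 (begin
          16 * (M * M * paths β I h)                             ≡⟨ *-assoc 16 (M * M) _ ⟨
          16 * (M * M) * paths β I h                             ≤⟨ quadratic-phase I base I 0 (+-identityʳ I) h ⟩
          8 * #paths ℓ I * M * X h + 8 * #paths ℓ I * (m * m)    ≤⟨ ≤-slack _ (eq₄ (#paths ℓ I) M (X h) m) ⟩
          16 * (#paths ℓ I * (M * X h + m * m))                  ∎)
          where
          eq₄ : ∀ T M x m → 8 * T * M * x + 8 * T * (m * m) + 8 * T * (M * x + m * m) ≡ 16 * (T * (M * x + m * m))
          eq₄ = solve-∀
        -- The ratios of `M + 3 * K` and `M + 4 * K` to `M + K` are at most 3 and 4, however large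
        -- `K` is.
        pointwise : ∀ h → M * M * paths β (k + I) h ≤ 3 * T * M * X h + 4 * T * (m * m)
        pointwise h with K , M+K≡ ← m≤n⇒∃[o]m+o≡n (^-monoʳ-≤ 2 (≤-trans (m≤n+m (I + ℓ) k) (≤-reflexive (sym (+-assoc k I ℓ))))) =
          *-cancelˡ-≤ (M + K) {{subst NonZero (sym M+K≡) (m^n≢0 2 D)}} (begin
            (M + K) * (M * M * paths β (k + I) h)                          ≡⟨ eq₄ M K (paths β (k + I) h) ⟩
            M * M * (M + K) * paths β (k + I) h                            ≤⟨ linear-phase I quadratic-end k K M+K≡ h ⟩
            T * M * (M + 3 * K) * X h + T * (m * m) * (M + 4 * K)          ≤⟨ ≤-slack _ (eq₅ M K T (X h) m) ⟩
            (M + K) * (3 * T * M * X h + 4 * T * (m * m))                  ∎)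
          where
          eq₄ : ∀ M K c → (M + K) * (M * M * c) ≡ M * M * (M + K) * c
          eq₄ = solve-∀
          eq₅ : ∀ M K T x m → T * M * (M + 3 * K) * x + T * (m * m) * (M + 4 * K) + (2 * T * M * M * x + 3 * T * M * (m * m))
              ≡ (M + K) * (3 * T * M * x + 4 * T * (m * m))
          eq₅ = solve-∀
        averaged : M * M * C ≤ 3 * T * M * Y + 4 * T * (m * m) * L
        averaged = begin
          M * M * C                                                 ≡⟨ ∑-*ˡ (allLinMaps u D) (M * M) _ ⟨
          ∑L u D (λ h → M * M * paths β (k + I) h)                  ≤⟨ ∑-mono (allLinMaps u D) pointwise ⟩
          ∑L u D (λ h → 3 * T * M * X h + 4 * T * (m * m))          ≡⟨ trans (∑-+ (allLinMaps u D) _ _) (cong₂ _+_ (∑-*ˡ (allLinMaps u D) (3 * T * M) X)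
                                                                         (trans (∑-const (allLinMaps u D) _) (*-comm L _))) ⟩
          3 * T * M * Y + 4 * T * (m * m) * L                       ∎
        few-collisions : 12 * (ν * ν) * Y ≤ L
        few-collisions = *-cancelˡ-≤ (2 ^ D) {{m^n≢0 2 D}} (begin
          2 ^ D * (12 * (ν * ν) * Y)                     ≡⟨ eq₄ (2 ^ D) (12 * (ν * ν)) Y ⟩
          12 * (ν * ν) * (2 ^ D * Y)                     ≤⟨ *-monoʳ-≤ (12 * (ν * ν)) (∑L-X D) ⟩
          12 * (ν * ν) * (2 ^ m * (m * m) * L)           ≡⟨ *-assoc (12 * (ν * ν)) (2 ^ m * (m * m)) L ⟨
          k * L                                          ≤⟨ *-monoˡ-≤ L (≤-trans (n≤2^n k) (^-monoʳ-≤ 2 (≤-trans (m≤m+n k (I + ℓ)) (≤-reflexive (sym (+-assoc k I ℓ)))))) ⟩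
          2 ^ D * L                                      ∎)
          where
          eq₄ : ∀ a b c → a * (b * c) ≡ b * (a * c)
          eq₄ = solve-∀
        eq₁ : ∀ M ν C → 2 * (M * M) * (2 * (ν * ν) * C) ≡ 4 * (ν * ν) * (M * M * C)
        eq₁ = solve-∀
        eq₂ : ∀ ν T M Y m L → 4 * (ν * ν) * (3 * T * M * Y + 4 * T * (m * m) * L) ≡ T * M * (12 * (ν * ν) * Y) + T * L * (4 * ν * m * (4 * ν * m))
        eq₂ = solve-∀
        eq₃ : ∀ T M L → T * (M * M) * L + T * L * (M * M) ≡ 2 * (M * M) * (T * L)
        eq₃ = solve-∀

      -- At `M` bins failure is at most twice the mean of Ψ, which `∑L-G` bounds by `2 * M / m`.
      -- With `R * M ≤ 4 * m` this is at most `16 / R`, that is, `1 / (2ν²)`.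
      lower-tail : ∀ ν → 1 ≤ ν → 1 ≤ ℓ → 32 * (ν * ν) * (2 ^ ℓ * ℓ) ≤ m →
        (∀ h → β h ≡ 0 ⊎ ∃ λ y → 32 * (ν * ν) * (load h S y * 2 ^ ℓ) < m) → 2 * (ν * ν) * ∑L u ℓ β ≤ #L u ℓ
      lower-tail ν 1≤ν 1≤ℓ Rnℓ≤m underfull = average-paths β J (2 * (ν * ν))
        (*-cancelˡ-≤ (16 * (m * (E * M))) {{m*n≢0 16 (m * (E * M)) {{_}} {{m*n≢0 m (E * M) {{>-nonZero 1≤m}} {{m*n≢0 E M}}}}}} (begin
          16 * (m * (E * M)) * (2 * (ν * ν) * C)       ≡⟨ eq₁ m E M ν C ⟩
          R * m * (E * M * C)                          ≤⟨ *-monoʳ-≤ (R * m) averaged ⟩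
          R * m * (T * 2 * Y)                          ≡⟨ eq₂ R m T Y ⟩
          R * T * 2 * (m * Y)                          ≤⟨ *-monoʳ-≤ (R * T * 2) (∑L-G (J + ℓ)) ⟩
          R * T * 2 * (2 * (E * (M * M)) * L)          ≡⟨ eq₃ R T E M L ⟩
          4 * T * E * M * L * (R * M)                  ≤⟨ *-monoʳ-≤ (4 * T * E * M * L) RM≤4m ⟩
          4 * T * E * M * L * (2 * (2 * m))            ≡⟨ eq₄ T E M L m ⟩
          16 * (m * (E * M)) * (T * L)                 ∎))
        where
        open ≤-Reasoning
        bins = 2 ^ ℓ
        E = 2 ^ m
        R = 32 * (ν * ν)
        instance
          E≢0 : NonZero E
          E≢0 = m^n≢0 2 m
          bins≢0 : NonZero bins
          bins≢0 = m^n≢0 2 ℓ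
          R≢0 : NonZero R
          R≢0 = m*n≢0 32 (ν * ν) {{_}} {{m*n≢0 ν ν {{>-nonZero 1≤ν}} {{>-nonZero 1≤ν}}}}
          Rn≢0 : NonZero (R * bins)
          Rn≢0 = m*n≢0 R bins
        -- This places `R * M` between `2 * m` and `4 * m`: large enough for `J` squarings to detect
        -- an underfull bin, small enough for the final estimate.
        scale = power-multiple 2 ≤-refl (R * bins) (2 * m) (>-nonZero⁻¹ (R * bins)) (begin
          R * bins              ≡⟨ *-identityʳ (R * bins) ⟨
          R * bins * 1          ≤⟨ *-monoʳ-≤ (R * bins) 1≤ℓ ⟩
          R * bins * ℓ          ≡⟨ *-assoc R bins ℓ ⟩
          R * (bins * ℓ)        ≤⟨ Rnℓ≤m ⟩
          m                  ≤⟨ m≤n*m m 2 ⟩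
          2 * m              ∎)
        J = proj₁ scale
        M = 2 ^ (J + ℓ)
        instance
          M≢0 : NonZero M
          M≢0 = m^n≢0 2 (J + ℓ)
        RM≤4m : R * M ≤ 2 * (2 * m)
        RM≤4m = ≤-trans (≤-reflexive (trans (cong (R *_) (trans (^-distribˡ-+-* 2 J ℓ) (*-comm (2 ^ J) bins))) (sym (*-assoc R bins (2 ^ J)))))
                  (proj₂ (proj₂ scale))
        T = #paths ℓ J
        L = #L u (J + ℓ)
        Y = ∑L u (J + ℓ) G
        C = ∑L u (J + ℓ) (paths β J)
        base : ∀ h → E * bins * β h ≤ 1 * tower J * G h
        base h with underfull h
        ... | inj₁ β≡0 = ≤-trans (≤-reflexive (trans (cong (E * bins *_) β≡0) (*-zeroʳ (E * bins)))) z≤n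
        ... | inj₂ (y , under) = begin
          E * bins * β h                     ≤⟨ *-monoʳ-≤ (E * bins) (β≤1 h) ⟩
          E * bins * 1                       ≡⟨ *-identityʳ (E * bins) ⟩
          E * bins                           ≡⟨ ^-distribˡ-+-* 2 m ℓ ⟨
          2 ^ (m + ℓ)                     ≤⟨ ^-monoʳ-≤ 2 exponents ⟩
          2 ^ (2 ^ J + (m ∸ f))           ≡⟨ ^-distribˡ-+-* 2 (2 ^ J) (m ∸ f) ⟩
          2 ^ (2 ^ J) * 2 ^ (m ∸ f)       ≡⟨ cong (_* 2 ^ (m ∸ f)) (tower≡2^2^ J) ⟨
          tower J * 2 ^ (m ∸ f)           ≤⟨ *-monoʳ-≤ (tower J) (∑-∈ (λ y → 2 ^ (m ∸ load h S y)) (∈-all𝔽₂^ y)) ⟩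
          tower J * G h                   ≡⟨ cong (_* G h) (*-identityˡ (tower J)) ⟨
          1 * tower J * G h               ∎
          where
          f = load h S y
          eq₅ : ∀ R bins f l → R * bins * (f + l) ≡ R * (f * bins) + R * (bins * l)
          eq₅ = solve-∀
          -- Of the `2 * m` available, one `m` pays for the load of the underfull bin and the other
          -- for `ℓ`, which compensates for averaging over `bins` bins.
          small : f + ℓ ≤ 2 ^ J
          small = *-cancelˡ-≤ (R * bins) (begin
            R * bins * (f + ℓ)                  ≡⟨ eq₅ R bins f ℓ ⟩
            R * (f * bins) + R * (bins * ℓ)        ≤⟨ +-mono-≤ (<⇒≤ under) Rnℓ≤m ⟩
            m + m                            ≡⟨ cong (m +_) (+-identityʳ m) ⟨
            2 * m                            ≤⟨ proj₁ (proj₂ scale) ⟩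
            R * bins * 2 ^ J                    ∎)
          eq₆ : ∀ f k l → f + k + l ≡ f + l + k
          eq₆ = solve-∀
          exponents : m + ℓ ≤ 2 ^ J + (m ∸ f)
          exponents = begin
            m + ℓ                    ≡⟨ cong (_+ ℓ) (m+[n∸m]≡n (load-≤ h S y)) ⟨
            f + (m ∸ f) + ℓ          ≡⟨ eq₆ f (m ∸ f) ℓ ⟩
            f + ℓ + (m ∸ f)          ≤⟨ +-monoˡ-≤ (m ∸ f) small ⟩
            2 ^ J + (m ∸ f)          ∎
        averaged : E * M * C ≤ T * 2 * Y
        averaged = begin
          E * M * C                                         ≡⟨ ∑-*ˡ (allLinMaps u (J + ℓ)) (E * M) _ ⟨
          ∑L u (J + ℓ) (λ h → E * M * paths β J h)          ≤⟨ ∑-mono (allLinMaps u (J + ℓ)) (squaring-phase J base J 0 (+-identityʳ J)) ⟩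
          ∑L u (J + ℓ) (λ h → T * 2 * G h)                  ≡⟨ ∑-*ˡ (allLinMaps u (J + ℓ)) (T * 2) G ⟩
          T * 2 * Y                                         ∎
        eq₁ : ∀ m E M ν C → 16 * (m * (E * M)) * (2 * (ν * ν) * C) ≡ 32 * (ν * ν) * m * (E * M * C)
        eq₁ = solve-∀
        eq₂ : ∀ R m T Y → R * m * (T * 2 * Y) ≡ R * T * 2 * (m * Y)
        eq₂ = solve-∀
        eq₃ : ∀ R T E M L → R * T * 2 * (2 * (E * (M * M)) * L) ≡ 4 * T * E * M * L * (R * M)
        eq₃ = solve-∀
        eq₄ : ∀ T E M L m → 4 * T * E * M * L * (2 * (2 * m)) ≡ 16 * (m * (E * M)) * (T * L)
        eq₄ = solve-∀

open Counting

-- Embedding of the natural numbers into ℚ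

open import Data.Integer as ℤ using (+_)
import Data.Integer.Properties as ℤP
open import Data.Rational using (ℚ; 0ℚ; 1ℚ; ½; _<_; _≤_; _*_; _-_; _+_; -_; _/_; mkℚ; *<*; toℚᵘ; Positive; NonNegative; positive; nonNegative)
import Data.Rational.Properties as ℚP
import Data.Rational.Unnormalised as ℚᵘ
import Data.Rational.Unnormalised.Properties as ℚᵘP
open import Data.Rational.Solver using (module +-*-Solver)

toℚᵘ-ℕtoℚ : ∀ a → toℚᵘ (ℕtoℚ a) ℚᵘ.≃ ℚᵘ.mkℚᵘ (+ a) 0
toℚᵘ-ℕtoℚ a = ℚP.toℚᵘ-fromℚᵘ (ℚᵘ.mkℚᵘ (+ a) 0)

-- Among unnormalised fractions both sides have denominator 1, so only integer numerators have to be
-- compared.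
ℕtoℚ-* : ∀ a b → ℕtoℚ (a ℕ.* b) ≡ ℕtoℚ a * ℕtoℚ b
ℕtoℚ-* a b = ℚP.toℚᵘ-injective (begin
  toℚᵘ (ℕtoℚ (a ℕ.* b))                            ≈⟨ toℚᵘ-ℕtoℚ (a ℕ.* b) ⟩
  ℚᵘ.mkℚᵘ (+ (a ℕ.* b)) 0                          ≈⟨ ℚᵘ.*≡* (cong (ℤ._* (+ 1)) (ℤP.pos-* a b)) ⟩
  ℚᵘ.mkℚᵘ (+ a) 0 ℚᵘ.* ℚᵘ.mkℚᵘ (+ b) 0             ≈⟨ ℚᵘP.*-cong (toℚᵘ-ℕtoℚ a) (toℚᵘ-ℕtoℚ b) ⟨
  toℚᵘ (ℕtoℚ a) ℚᵘ.* toℚᵘ (ℕtoℚ b)                 ≈⟨ ℚP.toℚᵘ-homo-* (ℕtoℚ a) (ℕtoℚ b) ⟨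
  toℚᵘ (ℕtoℚ a * ℕtoℚ b)                           ∎)
  where open import Relation.Binary.Reasoning.Setoid ℚᵘP.≃-setoid

ℕtoℚ-+ : ∀ a b → ℕtoℚ (a ℕ.+ b) ≡ ℕtoℚ a + ℕtoℚ b
ℕtoℚ-+ a b = ℚP.toℚᵘ-injective (begin
  toℚᵘ (ℕtoℚ (a ℕ.+ b))                            ≈⟨ toℚᵘ-ℕtoℚ (a ℕ.+ b) ⟩
  ℚᵘ.mkℚᵘ (+ (a ℕ.+ b)) 0                          ≈⟨ ℚᵘ.*≡* (cong (ℤ._* (+ 1)) (trans (ℤP.pos-+ a b)
                                                        (cong₂ ℤ._+_ (sym (ℤP.*-identityʳ (+ a))) (sym (ℤP.*-identityʳ (+ b)))))) ⟩
  ℚᵘ.mkℚᵘ (+ a) 0 ℚᵘ.+ ℚᵘ.mkℚᵘ (+ b) 0             ≈⟨ ℚᵘP.+-cong (toℚᵘ-ℕtoℚ a) (toℚᵘ-ℕtoℚ b) ⟨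
  toℚᵘ (ℕtoℚ a) ℚᵘ.+ toℚᵘ (ℕtoℚ b)                 ≈⟨ ℚP.toℚᵘ-homo-+ (ℕtoℚ a) (ℕtoℚ b) ⟨
  toℚᵘ (ℕtoℚ a + ℕtoℚ b)                           ∎)
  where open import Relation.Binary.Reasoning.Setoid ℚᵘP.≃-setoid

ℕtoℚ-mono-≤ : ∀ {a b} → a ℕ.≤ b → ℕtoℚ a ≤ ℕtoℚ b
ℕtoℚ-mono-≤ {a} {b} a≤b = ℚP.toℚᵘ-cancel-≤ (ℚᵘP.≤-respˡ-≃ (ℚᵘP.≃-sym (toℚᵘ-ℕtoℚ a)) (ℚᵘP.≤-respʳ-≃ (ℚᵘP.≃-sym (toℚᵘ-ℕtoℚ b))
  (ℚᵘ.*≤* (ℤP.*-monoʳ-≤-nonNeg (+ 1) (ℤ.+≤+ a≤b)))))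

ℕtoℚ-cancel-≤ : ∀ {a b} → ℕtoℚ a ≤ ℕtoℚ b → a ℕ.≤ b
ℕtoℚ-cancel-≤ {a} {b} le with ℚᵘP.≤-respˡ-≃ (toℚᵘ-ℕtoℚ a) (ℚᵘP.≤-respʳ-≃ (toℚᵘ-ℕtoℚ b) (ℚP.toℚᵘ-mono-≤ le))
... | ℚᵘ.*≤* p = ℤP.drop‿+≤+ (ℤP.*-cancelʳ-≤-pos (+ a) (+ b) (+ 1) p)

ℕtoℚ-mono-< : ∀ {a b} → a ℕ.< b → ℕtoℚ a < ℕtoℚ b
ℕtoℚ-mono-< {a} {b} a<b = ℚP.≰⇒> λ le → ℕP.<⇒≱ a<b (ℕtoℚ-cancel-≤ {b} {a} le)

ℕtoℚ-nonNeg : ∀ a → NonNegative (ℕtoℚ a)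
ℕtoℚ-nonNeg a = nonNegative (ℕtoℚ-mono-≤ {0} {a} z≤n)

ℕtoℚ-pos : ∀ a → 1 ℕ.≤ a → Positive (ℕtoℚ a)
ℕtoℚ-pos a 1≤a = positive (ℕtoℚ-mono-< {0} {a} 1≤a)

ℕtoℚ-*-/ : ∀ i k .{{_ : NonZero k}} → ℕtoℚ k * (i / k) ≡ i / 1
ℕtoℚ-*-/ i k@(suc k-1) = ℚP.toℚᵘ-injective (begin
  toℚᵘ (ℕtoℚ k * (i / k))                   ≈⟨ ℚP.toℚᵘ-homo-* (ℕtoℚ k) (i / k) ⟩
  toℚᵘ (ℕtoℚ k) ℚᵘ.* toℚᵘ (i / k)           ≈⟨ ℚᵘP.*-cong (toℚᵘ-ℕtoℚ k) (ℚP.toℚᵘ-fromℚᵘ (ℚᵘ.mkℚᵘ i k-1)) ⟩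
  ℚᵘ.mkℚᵘ (+ k) 0 ℚᵘ.* ℚᵘ.mkℚᵘ i k-1        ≈⟨ ℚᵘ.*≡* (trans (ℤP.*-identityʳ (+ k ℤ.* i)) (trans (ℤP.*-comm (+ k) i)
                                                 (cong (λ z → i ℤ.* (+ z)) (sym (ℕP.*-identityˡ k))))) ⟩
  ℚᵘ.mkℚᵘ i 0                               ≈⟨ ℚP.toℚᵘ-fromℚᵘ (ℚᵘ.mkℚᵘ i 0) ⟨
  toℚᵘ (i / 1)                              ∎)
  where open import Relation.Binary.Reasoning.Setoid ℚᵘP.≃-setoid

-- Powers, and an approximate inverse square root

^ℚ-pos : ∀ {q} → 0ℚ < q → ∀ k → 0ℚ < q ^ℚ k
^ℚ-pos 0<q zero    = ℚP.positive⁻¹ 1ℚ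
^ℚ-pos {q} 0<q (suc k) = ℚP.≤-<-trans (ℚP.≤-reflexive (sym (ℚP.*-zeroʳ q)))
  (ℚP.*-monoʳ-<-pos q {{positive 0<q}} (^ℚ-pos 0<q k))

^ℚ-≤1 : ∀ {q} → 0ℚ < q → q ≤ 1ℚ → ∀ k → q ^ℚ k ≤ 1ℚ
^ℚ-≤1 0<q q≤1 zero    = ℚP.≤-refl
^ℚ-≤1 {q} 0<q q≤1 (suc k) = ℚP.≤-trans (ℚP.*-monoˡ-≤-nonNeg q {{nonNegative (ℚP.<⇒≤ 0<q)}} (^ℚ-≤1 0<q q≤1 k))
  (ℚP.≤-trans (ℚP.≤-reflexive (ℚP.*-identityʳ q)) q≤1)

^ℚ-≤ : ∀ {q} → 0ℚ < q → q ≤ 1ℚ → ∀ k → q ^ℚ suc k ≤ q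
^ℚ-≤ {q} 0<q q≤1 k = ℚP.≤-trans (ℚP.*-monoˡ-≤-nonNeg q {{nonNegative (ℚP.<⇒≤ 0<q)}} (^ℚ-≤1 0<q q≤1 k))
  (ℚP.≤-reflexive (ℚP.*-identityʳ q))

4^≡2^*2^ : ∀ i → 4 ^ i ≡ 2 ^ i ℕ.* 2 ^ i
4^≡2^*2^ zero    = refl
4^≡2^*2^ (suc i) = trans (cong (4 ℕ.*_) (4^≡2^*2^ i)) (eq (2 ^ i))
  where
  eq : ∀ p → 4 ℕ.* (p ℕ.* p) ≡ 2 ℕ.* p ℕ.* (2 ℕ.* p)
  eq = solve-∀

-- For `ε = p / q`, round `q` up to `p * 4 ^ i` and take `ν = 2 ^ i`: powers of 4 are squares, so no
-- root has to be extracted.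
inverse-square : ∀ ε → 0ℚ < ε → ε < 1ℚ →
  ∃ λ ν → 1 ℕ.≤ ν × 1ℚ ≤ ℕtoℚ (ν ℕ.* ν) * ε × ℕtoℚ (ν ℕ.* ν) * ε ≤ ℕtoℚ 4
inverse-square (mkℚ (+ zero) _ _)  (*<* (ℤ.+<+ ())) ε<1
inverse-square (mkℚ (ℤ.-[1+ _ ]) _ _) (*<* ()) ε<1
inverse-square ε@(mkℚ (+ p@(suc _)) q-1 _) 0<ε (*<* ε<1)
  with i , q≤ , ≤4q ← power-multiple 4 (s≤s (s≤s z≤n)) p (suc q-1) (s≤s z≤n)
         (ℕP.<⇒≤ (ℤP.drop‿+<+ (subst (ℤ._< (+ (suc q-1))) (ℤP.*-identityʳ (+ p)) (subst ((+ p ℤ.* + 1) ℤ.<_) (ℤP.*-identityˡ (+ suc q-1)) ε<1))))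
  = 2 ^ i , ℕP.m^n>0 2 i
  , ℚP.*-cancelˡ-≤-pos (ℕtoℚ q) {{ℕtoℚ-pos q (s≤s z≤n)}} (begin
      ℕtoℚ q * 1ℚ               ≡⟨ ℚP.*-identityʳ (ℕtoℚ q) ⟩
      ℕtoℚ q                    ≤⟨ ℕtoℚ-mono-≤ {q} {p ℕ.* 4 ^ i} q≤ ⟩
      ℕtoℚ (p ℕ.* 4 ^ i)        ≡⟨ scaled ⟨
      ℕtoℚ q * (v * ε)          ∎)
  , ℚP.*-cancelˡ-≤-pos (ℕtoℚ q) {{ℕtoℚ-pos q (s≤s z≤n)}} (begin
      ℕtoℚ q * (v * ε)          ≡⟨ scaled ⟩
      ℕtoℚ (p ℕ.* 4 ^ i)        ≤⟨ ℕtoℚ-mono-≤ {p ℕ.* 4 ^ i} {4 ℕ.* q} ≤4q ⟩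
      ℕtoℚ (4 ℕ.* q)            ≡⟨ trans (ℕtoℚ-* 4 q) (ℚP.*-comm (ℕtoℚ 4) (ℕtoℚ q)) ⟩
      ℕtoℚ q * ℕtoℚ 4           ∎)
  where
  open ℚP.≤-Reasoning
  q = suc q-1
  v = ℕtoℚ (2 ^ i ℕ.* 2 ^ i)
  scaled : ℕtoℚ q * (v * ε) ≡ ℕtoℚ (p ℕ.* 4 ^ i)
  scaled = begin-equality
    ℕtoℚ q * (v * ε)                     ≡⟨ +-*-Solver.solve 3 (λ q v e → q :* (v :* e) := q :* e :* v) refl (ℕtoℚ q) v ε ⟩
    ℕtoℚ q * ε * v                       ≡⟨ cong (λ z → ℕtoℚ q * z * v) (ℚP.↥p/↧p≡p ε) ⟨
    ℕtoℚ q * ((+ p) / q) * v             ≡⟨ cong (_* v) (ℕtoℚ-*-/ (+ p) q) ⟩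
    ℕtoℚ p * v                           ≡⟨ cong (λ z → ℕtoℚ p * ℕtoℚ z) (4^≡2^*2^ i) ⟨
    ℕtoℚ p * ℕtoℚ (4 ^ i)                ≡⟨ ℕtoℚ-* p (4 ^ i) ⟨
    ℕtoℚ (p ℕ.* 4 ^ i)                   ∎
    where open +-*-Solver using (_:*_; _:=_)

-- Union bound for the two tails

any-ind : {A : Set} {P : A → Set} (P? : Decidable P) (xs : List A) → ind (any? P? xs) ≡ 0 ⊎ ∃ P
any-ind P? xs with any? P? xs
... | yes p = inj₂ (Any.satisfied p)
... | no _  = inj₁ refl

-- The union bound for a single map; summing it over all maps compares the counts directly.
ind-cover : {A B G : Set} (g : Dec G) (a : Dec A) (b : Dec B) → (¬ A → ¬ B → G) → 1 ℕ.≤ ind g ℕ.+ (ind a ℕ.+ ind b)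
ind-cover (yes _) a       b       _ = s≤s z≤n
ind-cover (no _)  (yes _) b       _ = s≤s z≤n
ind-cover (no _)  (no _)  (yes _) _ = s≤s z≤n
ind-cover (no ¬g) (no ¬a) (no ¬b) f = contradiction (f ¬a ¬b) ¬g

module _ (ν : ℕ) (1≤ν : 1 ℕ.≤ ν) where

  private
    R : ℕ
    R = 32 ℕ.* (ν ℕ.* ν)

  instance
    R≢0 : NonZero R
    R≢0 = ℕP.m*n≢0 32 (ν ℕ.* ν) {{_}} {{ℕP.m*n≢0 ν ν {{ℕ.>-nonZero 1≤ν}} {{ℕ.>-nonZero 1≤ν}}}}

  -- The thresholds of `lower-tail` and `upper-tail`. For `ν` of order `ε^(−1/2)` they are of order
  -- `ε` and `ε^(−1/2)`.
  C₁ C₂ : ℚ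
  C₁ = (+ 1) / R
  C₂ = ℕtoℚ (33 ℕ.* ν)

  R*C₁ : ℕtoℚ R * C₁ ≡ 1ℚ
  R*C₁ = ℕtoℚ-*-/ (+ 1) R

  R-pos : Positive (ℕtoℚ R)
  R-pos = ℕtoℚ-pos R (ℕ.>-nonZero⁻¹ R)

  R*[C₁*] : ∀ q → ℕtoℚ R * (C₁ * q) ≡ q
  R*[C₁*] q = trans (sym (ℚP.*-assoc (ℕtoℚ R) C₁ q)) (trans (cong (_* q) R*C₁) (ℚP.*-identityˡ q))

  scaled-lower : ∀ m f n → m ℕ.≤ R ℕ.* (f ℕ.* n) → C₁ * ℕtoℚ m ≤ ℕtoℚ f * ℕtoℚ n
  scaled-lower m f n le = ℚP.*-cancelˡ-≤-pos (ℕtoℚ R) {{R-pos}} (begin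
    ℕtoℚ R * (C₁ * ℕtoℚ m)           ≡⟨ R*[C₁*] (ℕtoℚ m) ⟩
    ℕtoℚ m                           ≤⟨ ℕtoℚ-mono-≤ {m} {R ℕ.* (f ℕ.* n)} le ⟩
    ℕtoℚ (R ℕ.* (f ℕ.* n))           ≡⟨ trans (ℕtoℚ-* R (f ℕ.* n)) (cong (ℕtoℚ R *_) (ℕtoℚ-* f n)) ⟩
    ℕtoℚ R * (ℕtoℚ f * ℕtoℚ n)       ∎)
    where open ℚP.≤-Reasoning

  scaled-upper : ∀ m f n → f ℕ.* n ℕ.≤ 33 ℕ.* ν ℕ.* m → ℕtoℚ f * ℕtoℚ n ≤ C₂ * ℕtoℚ m
  scaled-upper m f n le = begin
    ℕtoℚ f * ℕtoℚ n                  ≡⟨ ℕtoℚ-* f n ⟨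
    ℕtoℚ (f ℕ.* n)                   ≤⟨ ℕtoℚ-mono-≤ {f ℕ.* n} {33 ℕ.* ν ℕ.* m} le ⟩
    ℕtoℚ (33 ℕ.* ν ℕ.* m)            ≡⟨ ℕtoℚ-* (33 ℕ.* ν) m ⟩
    C₂ * ℕtoℚ m                      ∎
    where open ℚP.≤-Reasoning

  module _ {u ℓ : ℕ} (S : List (𝔽₂^ u)) where

    overfull? : (h : LinMap u ℓ) → Decidable (λ y → 33 ℕ.* ν ℕ.* length S ℕ.< load h S y ℕ.* 2 ^ ℓ)
    overfull? h y = _ ℕP.<? _

    underfull? : (h : LinMap u ℓ) → Decidable (λ y → R ℕ.* (load h S y ℕ.* 2 ^ ℓ) ℕ.< length S)
    underfull? h y = _ ℕP.<? _

    over under good : LinMap u ℓ → ℕ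
    over  h = ind (any? (overfull? h) (all𝔽₂^ ℓ))
    under h = ind (any? (underfull? h) (all𝔽₂^ ℓ))
    good  h = ind (balanced? C₁ C₂ (2 ^ ℓ) (length S) S h)

    bin-balanced : ∀ (h : LinMap u ℓ) {y} → ¬ (33 ℕ.* ν ℕ.* length S ℕ.< load h S y ℕ.* 2 ^ ℓ) →
      ¬ (R ℕ.* (load h S y ℕ.* 2 ^ ℓ) ℕ.< length S) →
      (C₁ * ℕtoℚ (length S) ≤ ℕtoℚ (preimageCount h S y) * ℕtoℚ (2 ^ ℓ)) ×
      (ℕtoℚ (preimageCount h S y) * ℕtoℚ (2 ^ ℓ) ≤ C₂ * ℕtoℚ (length S))
    bin-balanced h {y} ¬over ¬under =
        scaled-lower (length S) (preimageCount h S y) (2 ^ ℓ) (subst (λ f → length S ℕ.≤ R ℕ.* (f ℕ.* 2 ^ ℓ)) (sym (preimageCount≡load h S y)) (ℕP.≮⇒≥ ¬under))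
      , scaled-upper (length S) (preimageCount h S y) (2 ^ ℓ) (subst (λ f → f ℕ.* 2 ^ ℓ ℕ.≤ 33 ℕ.* ν ℕ.* length S) (sym (preimageCount≡load h S y)) (ℕP.≮⇒≥ ¬over))

    trichotomy : ∀ h → 1 ℕ.≤ good h ℕ.+ (over h ℕ.+ under h)
    trichotomy h = ind-cover (balanced? C₁ C₂ (2 ^ ℓ) (length S) S h)
      (any? (overfull? h) (all𝔽₂^ ℓ)) (any? (underfull? h) (all𝔽₂^ ℓ))
      (λ none none′ → All.zipWith (λ (¬o , ¬u) → bin-balanced h ¬o ¬u) (¬Any⇒All¬ _ none , ¬Any⇒All¬ _ none′))

    -- Each tail costs at most `1 / (2ν²)`, so at most a fraction `1 / ν²` of the maps is
    -- unbalanced.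
    good-fraction : Unique S → 1 ℕ.≤ length S → 1 ℕ.≤ ℓ → R ℕ.* (2 ^ ℓ ℕ.* ℓ) ℕ.≤ length S →
      ν ℕ.* ν ℕ.* #L u ℓ ℕ.≤ ν ℕ.* ν ℕ.* goodCount u ℓ C₁ C₂ (2 ^ ℓ) (length S) S ℕ.+ #L u ℓ
    good-fraction uniq 1≤m 1≤ℓ Rnℓ≤m = ℕP.*-cancelˡ-≤ 2 (begin
      2 ℕ.* (ν ℕ.* ν ℕ.* #L u ℓ)                          ≤⟨ ℕP.*-monoʳ-≤ 2 (ℕP.*-monoʳ-≤ (ν ℕ.* ν) total) ⟩
      2 ℕ.* (ν ℕ.* ν ℕ.* (g ℕ.+ (o ℕ.+ l)))               ≡⟨ eq₁ ν g o l ⟩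
      2 ℕ.* (ν ℕ.* ν ℕ.* g) ℕ.+ (2 ℕ.* (ν ℕ.* ν) ℕ.* o ℕ.+ 2 ℕ.* (ν ℕ.* ν) ℕ.* l)
        ≤⟨ ℕP.+-monoʳ-≤ (2 ℕ.* (ν ℕ.* ν ℕ.* g)) (ℕP.+-mono-≤
             (upper-tail over (λ h → ind-≤1 (any? (overfull? h) (all𝔽₂^ ℓ))) ν 1≤ν 1≤ℓ (ℕP.≤-trans (ℕP.m≤n*m _ R) Rnℓ≤m) (λ h → any-ind (overfull? h) (all𝔽₂^ ℓ)))
             (lower-tail under (λ h → ind-≤1 (any? (underfull? h) (all𝔽₂^ ℓ))) ν 1≤ν 1≤ℓ Rnℓ≤m (λ h → any-ind (underfull? h) (all𝔽₂^ ℓ)))) ⟩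
      2 ℕ.* (ν ℕ.* ν ℕ.* g) ℕ.+ (#L u ℓ ℕ.+ #L u ℓ)       ≡⟨ eq₂ (ν ℕ.* ν ℕ.* g) (#L u ℓ) ⟩
      2 ℕ.* (ν ℕ.* ν ℕ.* g ℕ.+ #L u ℓ)                    ≡⟨ cong (λ z → 2 ℕ.* (ν ℕ.* ν ℕ.* z ℕ.+ #L u ℓ)) (length-filter (balanced? C₁ C₂ (2 ^ ℓ) (length S) S) (allLinMaps u ℓ)) ⟨
      2 ℕ.* (ν ℕ.* ν ℕ.* goodCount u ℓ C₁ C₂ (2 ^ ℓ) (length S) S ℕ.+ #L u ℓ) ∎)
      where
      open ℕP.≤-Reasoning
      open Tails S uniq 1≤m using (upper-tail; lower-tail)
      g = ∑L u ℓ good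
      o = ∑L u ℓ over
      l = ∑L u ℓ under
      total : #L u ℓ ℕ.≤ g ℕ.+ (o ℕ.+ l)
      total = begin
        #L u ℓ                                              ≡⟨ length-∑ (allLinMaps u ℓ) ⟩
        ∑L u ℓ (λ _ → 1)                                    ≤⟨ ∑-mono (allLinMaps u ℓ) trichotomy ⟩
        ∑L u ℓ (λ h → good h ℕ.+ (over h ℕ.+ under h))      ≡⟨ trans (∑-+ (allLinMaps u ℓ) good _) (cong (g ℕ.+_) (∑-+ (allLinMaps u ℓ) over under)) ⟩
        g ℕ.+ (o ℕ.+ l)                                     ∎
      eq₁ : ∀ ν g o l → 2 ℕ.* (ν ℕ.* ν ℕ.* (g ℕ.+ (o ℕ.+ l))) ≡ 2 ℕ.* (ν ℕ.* ν ℕ.* g) ℕ.+ (2 ℕ.* (ν ℕ.* ν) ℕ.* o ℕ.+ 2 ℕ.* (ν ℕ.* ν) ℕ.* l)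
      eq₁ = solve-∀
      eq₂ : ∀ a b → 2 ℕ.* a ℕ.+ (b ℕ.+ b) ≡ 2 ℕ.* (a ℕ.+ b)
      eq₂ = solve-∀

-- Comparison of rational constants

module Arithmetic where
  open ℚP.≤-Reasoning
  open +-*-Solver using (_:*_; _:+_; _:-_; _:=_; con) renaming (solve to ring)

  inverse-pos : ∀ r C → Positive r → r * C ≡ 1ℚ → 0ℚ < C
  inverse-pos r C r>0 rC≡1 = ℚP.*-cancelˡ-<-nonNeg r {{ℚP.pos⇒nonNeg r {{r>0}}}} (begin-strict
    r * 0ℚ        ≡⟨ ℚP.*-zeroʳ r ⟩
    0ℚ            <⟨ ℚP.positive⁻¹ 1ℚ ⟩
    1ℚ            ≡⟨ rC≡1 ⟨
    r * C         ∎)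

  inverse-< : ∀ r C D → Positive r → r * C ≡ 1ℚ → 1ℚ < r * D → C < D
  inverse-< r C D r>0 rC≡1 1<rD = ℚP.*-cancelˡ-<-nonNeg r {{ℚP.pos⇒nonNeg r {{r>0}}}} (begin-strict
    r * C         ≡⟨ rC≡1 ⟩
    1ℚ            <⟨ 1<rD ⟩
    r * D         ∎)

  -- `C` is `1 / (a * v)` and `v * ε ≤ b`, so `C` is at least `ε / (a * b)`, which is `c * ε`.
  inverse-≥ : ∀ r C a v c b ε e → Positive r → NonNegative c → NonNegative (a * c) → r ≡ a * v → r * C ≡ 1ℚ →
    a * c * b ≡ 1ℚ → v * ε ≤ b → e ≤ ε → c * e ≤ C
  inverse-≥ r C a v c b ε e r>0 c≥0 ac≥0 r≡av rC≡1 acb≡1 vε≤b e≤ε = ℚP.*-cancelˡ-≤-pos r {{r>0}} (begin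
    r * (c * e)         ≤⟨ ℚP.*-monoˡ-≤-nonNeg r {{ℚP.pos⇒nonNeg r {{r>0}}}} (ℚP.*-monoˡ-≤-nonNeg c {{c≥0}} e≤ε) ⟩
    r * (c * ε)         ≡⟨ cong (_* (c * ε)) r≡av ⟩
    a * v * (c * ε)     ≡⟨ ring 4 (λ a v c e → a :* v :* (c :* e) := a :* c :* (v :* e)) refl a v c ε ⟩
    a * c * (v * ε)     ≤⟨ ℚP.*-monoˡ-≤-nonNeg (a * c) {{ac≥0}} vε≤b ⟩
    a * c * b           ≡⟨ acb≡1 ⟩
    1ℚ                  ≡⟨ rC≡1 ⟨
    r * C               ∎)

  square-≤ : ∀ D a x v b ε → NonNegative (a * a) → D ≡ a * x → v ≡ x * x → v * ε ≤ b → D * D * ε ≤ a * a * b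
  square-≤ D a x v b ε aa≥0 D≡ax v≡xx vε≤b = begin
    D * D * ε                  ≡⟨ cong (λ z → z * z * ε) D≡ax ⟩
    (a * x) * (a * x) * ε      ≡⟨ ring 3 (λ a x e → (a :* x) :* (a :* x) :* e := a :* a :* (x :* x :* e)) refl a x ε ⟩
    a * a * (x * x * ε)        ≡⟨ cong (λ z → a * a * (z * ε)) v≡xx ⟨
    a * a * (v * ε)            ≤⟨ ℚP.*-monoˡ-≤-nonNeg (a * a) {{aa≥0}} vε≤b ⟩
    a * a * b                  ∎

  -- At most `t / v` of the `t` maps are bad, and `1 ≤ v * ε` makes this at most `ε * t`.
  fraction-≥ : ∀ v t g ε → Positive v → NonNegative t → 1ℚ ≤ v * ε → v * t ≤ v * g + t → (1ℚ - ε) * t ≤ g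
  fraction-≥ v t g ε v>0 t≥0 1≤vε vt≤ = ℚP.*-cancelˡ-≤-pos v {{v>0}} (begin
    v * ((1ℚ - ε) * t)          ≡⟨ ring 3 (λ v e t → v :* ((con 1ℚ :- e) :* t) := v :* t :- v :* e :* t) refl v ε t ⟩
    v * t - v * ε * t           ≤⟨ ℚP.+-monoʳ-≤ (v * t) (ℚP.neg-antimono-≤ (ℚP.*-monoʳ-≤-nonNeg t {{t≥0}} 1≤vε)) ⟩
    v * t - 1ℚ * t              ≤⟨ ℚP.+-monoˡ-≤ (- (1ℚ * t)) vt≤ ⟩
    v * g + t - 1ℚ * t          ≡⟨ ring 3 (λ v g t → v :* g :+ t :- con 1ℚ :* t := v :* g) refl v g t ⟩
    v * g                       ∎)

theorem1p4 : Σ ℚ λ c → Σ ℚ λ K → 0ℚ < c × 0ℚ < K ×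
    ((ε : ℚ) → 0ℚ < ε → ε < ½ →
    Σ ℚ λ C₁ → Σ ℚ λ C₂ →
    0ℚ < C₁ × C₁ < C₂ × c * (ε ^ℚ 74) ≤ C₁ × C₂ * C₂ * ε ≤ K ×
    ((u ℓ m : ℕ) → 1 ℕ.≤ ℓ → ℓ ℕ.≤ u → 1 ℕ.≤ m →
    (S : List (𝔽₂^ u)) → Unique S → length S ≡ m →
    ℕtoℚ ((2 ^ ℓ) ℕ.* ℓ) ≤ C₁ * ℕtoℚ m →
    (1ℚ - ε) * ℕtoℚ (length (allLinMaps u ℓ))
    ≤ ℕtoℚ (goodCount u ℓ C₁ C₂ (2 ^ ℓ) m S)))
theorem1p4 = c , K , ℚP.positive⁻¹ c , ℚP.positive⁻¹ K , bounds
  where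
  open Arithmetic
  c K : ℚ
  -- 128 is 32 · 4, with 32 from `C₁` and 4 from the rounding in `inverse-square`. This gives
  -- `c * ε ≤ C₁`, and `ε ^ℚ 74 ≤ ε`.
  c = (+ 1) / 128
  -- `C₂ * C₂ * ε` is `33² ν² ε`, and `ν² ε ≤ 4`.
  K = ℕtoℚ 33 * ℕtoℚ 33 * ℕtoℚ 4
  bounds : (ε : ℚ) → 0ℚ < ε → ε < ½ → Σ ℚ λ C₁ → Σ ℚ λ C₂ →
    0ℚ < C₁ × C₁ < C₂ × c * (ε ^ℚ 74) ≤ C₁ × C₂ * C₂ * ε ≤ K ×
    ((u ℓ m : ℕ) → 1 ℕ.≤ ℓ → ℓ ℕ.≤ u → 1 ℕ.≤ m →
    (S : List (𝔽₂^ u)) → Unique S → length S ≡ m →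
    ℕtoℚ ((2 ^ ℓ) ℕ.* ℓ) ≤ C₁ * ℕtoℚ m →
    (1ℚ - ε) * ℕtoℚ (length (allLinMaps u ℓ)) ≤ ℕtoℚ (goodCount u ℓ C₁ C₂ (2 ^ ℓ) m S))
  bounds ε 0<ε ε<½ = C₁ ν 1≤ν , C₂ ν 1≤ν
    , inverse-pos r (C₁ ν 1≤ν) (R-pos ν 1≤ν) (R*C₁ ν 1≤ν)
    , inverse-< r (C₁ ν 1≤ν) (C₂ ν 1≤ν) (R-pos ν 1≤ν) (R*C₁ ν 1≤ν) 1<rC₂
    , inverse-≥ r (C₁ ν 1≤ν) (ℕtoℚ 32) v c (ℕtoℚ 4) ε (ε ^ℚ 74) (R-pos ν 1≤ν) _ _ (ℕtoℚ-* 32 (ν ℕ.* ν)) (R*C₁ ν 1≤ν) refl vε≤4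
        (^ℚ-≤ 0<ε (ℚP.<⇒≤ ε<1) 73)
    , square-≤ (C₂ ν 1≤ν) (ℕtoℚ 33) (ℕtoℚ ν) v (ℕtoℚ 4) ε _ (ℕtoℚ-* 33 ν) (ℕtoℚ-* ν ν) vε≤4
    , concentration
    where
    ε<1 : ε < 1ℚ
    ε<1 = ℚP.<-trans ε<½ (ℚP.toℚᵘ-cancel-< (ℚᵘ.*<* (ℤ.+<+ ℕP.≤-refl)))
    choice = inverse-square ε 0<ε ε<1
    ν = proj₁ choice
    1≤ν = proj₁ (proj₂ choice)
    R : ℕ
    R = 32 ℕ.* (ν ℕ.* ν)
    v r : ℚ
    v = ℕtoℚ (ν ℕ.* ν)
    r = ℕtoℚ R
    1≤vε : 1ℚ ≤ v * ε
    1≤vε = proj₁ (proj₂ (proj₂ choice))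
    vε≤4 : v * ε ≤ ℕtoℚ 4
    vε≤4 = proj₂ (proj₂ (proj₂ choice))
    1<R*33ν : 1 ℕ.< R ℕ.* (33 ℕ.* ν)
    1<R*33ν = ℕP.*-mono-≤ {2} {R} {1} (ℕP.≤-trans (s≤s (s≤s z≤n)) (ℕP.*-monoʳ-≤ 32 (ℕP.*-mono-≤ 1≤ν 1≤ν)))
                (ℕP.*-mono-≤ {1} {33} (s≤s z≤n) 1≤ν)
    1<rC₂ : 1ℚ < r * C₂ ν 1≤ν
    1<rC₂ = subst (1ℚ <_) (ℕtoℚ-* R (33 ℕ.* ν)) (ℕtoℚ-mono-< {1} {R ℕ.* (33 ℕ.* ν)} 1<R*33ν)
    concentration : (u ℓ m : ℕ) → 1 ℕ.≤ ℓ → ℓ ℕ.≤ u → 1 ℕ.≤ m →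
      (S : List (𝔽₂^ u)) → Unique S → length S ≡ m →
      ℕtoℚ ((2 ^ ℓ) ℕ.* ℓ) ≤ C₁ ν 1≤ν * ℕtoℚ m →
      (1ℚ - ε) * ℕtoℚ (length (allLinMaps u ℓ)) ≤ ℕtoℚ (goodCount u ℓ (C₁ ν 1≤ν) (C₂ ν 1≤ν) (2 ^ ℓ) m S)
    concentration u ℓ m 1≤ℓ _ 1≤m S uniq refl nℓ≤C₁m =
      fraction-≥ v t (ℕtoℚ good#) ε (ℕtoℚ-pos (ν ℕ.* ν) (ℕP.*-mono-≤ 1≤ν 1≤ν)) (ℕtoℚ-nonNeg (#L u ℓ)) 1≤vε vt≤vg+t
      where
      open ℚP.≤-Reasoning
      t = ℕtoℚ (#L u ℓ)
      good# = goodCount u ℓ (C₁ ν 1≤ν) (C₂ ν 1≤ν) (2 ^ ℓ) m S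
      -- The assumption on `m`, with `log n = ℓ`, multiplied by the inverse `R` of `C₁`.
      Rnℓ≤m : R ℕ.* (2 ^ ℓ ℕ.* ℓ) ℕ.≤ m
      Rnℓ≤m = ℕtoℚ-cancel-≤ {R ℕ.* (2 ^ ℓ ℕ.* ℓ)} {m} (begin
        ℕtoℚ (R ℕ.* (2 ^ ℓ ℕ.* ℓ))        ≡⟨ ℕtoℚ-* R (2 ^ ℓ ℕ.* ℓ) ⟩
        r * ℕtoℚ (2 ^ ℓ ℕ.* ℓ)            ≤⟨ ℚP.*-monoˡ-≤-nonNeg r {{ℕtoℚ-nonNeg R}} nℓ≤C₁m ⟩
        r * (C₁ ν 1≤ν * ℕtoℚ m)           ≡⟨ R*[C₁*] ν 1≤ν (ℕtoℚ m) ⟩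
        ℕtoℚ m                            ∎)
      vt≤vg+t : v * t ≤ v * ℕtoℚ good# + t
      vt≤vg+t = begin
        v * t                                       ≡⟨ ℕtoℚ-* (ν ℕ.* ν) (#L u ℓ) ⟨
        ℕtoℚ (ν ℕ.* ν ℕ.* #L u ℓ)                   ≤⟨ ℕtoℚ-mono-≤ {ν ℕ.* ν ℕ.* #L u ℓ} {ν ℕ.* ν ℕ.* good# ℕ.+ #L u ℓ} (good-fraction ν 1≤ν S uniq 1≤m 1≤ℓ Rnℓ≤m) ⟩
        ℕtoℚ (ν ℕ.* ν ℕ.* good# ℕ.+ #L u ℓ)         ≡⟨ ℕtoℚ-+ (ν ℕ.* ν ℕ.* good#) (#L u ℓ) ⟩
        ℕtoℚ (ν ℕ.* ν ℕ.* good#) + t                ≡⟨ cong (_+ t) (ℕtoℚ-* (ν ℕ.* ν) good#) ⟩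
        v * ℕtoℚ good# + t                          ∎
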